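{- Let $a=a(n)$ and $k=k(n)$ be positive integers (functions of $n$) with $k=o(n)$ and $a=o(\sqrt n)$. For every $\varepsilon>0$ there is an $n_0\in\mathbb N$ (depending on $\varepsilon$ and on the functions $a,k$) such that for every $n\ge n_0$ and every integer $b\ge(1+\varepsilon)\frac{an}{a+\ln n}$, Breaker has a winning strategy in the $(a:b)$ minimum-degree-$k$ Maker-Breaker game on $K_n$ in which Breaker moves first.
   Context: The $(a:b)$ minimum-degree-$k$ Maker-Breaker game on $K_n$: the board is the edge set of the complete graph $K_n$ on $n$ vertices. In each round Breaker first claims $b$ previously unclaimed edges, then Maker claims $a$ previously unclaimed edges (if fewer edges remain, a player claims all remaining ones). Maker wins if at the end of the game his edges form a spanning subgraph of minimum degree at least $k$; otherwise Breaker wins. -}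

module Defs where

open import Algebra.Bundles using (CommutativeMonoid)
import Algebra.Properties.CommutativeSemigroup as CommutativeSemigroupProperties
open import Data.Fin.Base as Fin using (Fin)
import Data.Fin.Properties as Finₚ
open import Data.Integer.Base as ℤ using (+_)
import Data.Integer.Properties as ℤₚ
open import Data.List.Base using (List; []; _∷_; _++_; concatMap; length; filter)
open import Data.List.Membership.Propositional using (_∈_)
open import Data.List.Relation.Binary.Disjoint.Propositional using (Disjoint)
open import Data.List.Relation.Unary.Unique.Propositional using (Unique)
open import Data.Nat.Base as ℕ using (ℕ; zero; suc)
import Data.Nat.Properties as ℕₚ
open import Data.Product.Base using (∃; ∃-syntax; ∃₂; _×_; _,_; proj₁; proj₂)
open import Data.Rational.Base as ℚ using (ℚ; 0ℚ; 1ℚ; _/_)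
import Data.Rational.Properties as ℚₚ
open import Data.Rational.Unnormalised.Base as ℚᵘ using (mkℚᵘ; *≤*; *≡*)
import Data.Rational.Unnormalised.Properties as ℚᵘₚ
open import Data.Sum.Base using (_⊎_)
open import Relation.Binary.PropositionalEquality
  using (_≡_; refl; sym; trans; cong; cong₂; subst; subst₂)
open import Relation.Nullary.Decidable using (Dec; _⊎-dec_)
open import Relation.Nullary.Negation using (¬_)

------------------------------------------------------------------------
-- Cauchy real numbers

-- The usual bound ∣ x i - x j ∣ ≤ δ, written one-sidedly: i and j range
-- over the same tail, so swapping them gives the other inequality.
IsCauchy : (ℕ → ℚ) → Set
IsCauchy x = ∀ δ → 0ℚ ℚ.< δ →
  ∃[ N ] ∀ i j → N ℕ.≤ i → N ℕ.≤ j → x i ℚ.≤ x j ℚ.+ δ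

record ℝ : Set where
  constructor mkℝ
  field
    approx : ℕ → ℚ
    cauchy : IsCauchy approx

open ℝ public

infix 4 _≤ℝ_ _<ℝ_ _≥ℝ_

_≤ℝ_ : ℝ → ℝ → Set
x ≤ℝ y = ∀ δ → 0ℚ ℚ.< δ → ∃[ N ] ∀ i → N ℕ.≤ i → approx x i ℚ.≤ approx y i ℚ.+ δ

_<ℝ_ : ℝ → ℝ → Set
x <ℝ y = ∃[ δ ] 0ℚ ℚ.< δ × ∃[ N ] ∀ i → N ℕ.≤ i → approx x i ℚ.+ δ ℚ.≤ approx y i

_≥ℝ_ : ℝ → ℝ → Set
x ≥ℝ y = y ≤ℝ x

private

  open CommutativeSemigroupProperties
    (CommutativeMonoid.commutativeSemigroup ℚₚ.+-0-commutativeMonoid)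
    using () renaming (interchange to +-interchange; xy∙z≈xz∙y to +-swap)

  ≤-self+ : ∀ q {δ} → 0ℚ ℚ.≤ δ → q ℚ.≤ q ℚ.+ δ
  ≤-self+ q 0≤δ = ℚₚ.≤-trans (ℚₚ.≤-reflexive (sym (ℚₚ.+-identityʳ q))) (ℚₚ.+-monoʳ-≤ q 0≤δ)

  unit : (d : ℕ) .{{_ : ℕ.NonZero d}} → ℚ
  unit d = + 1 / d

  unit>0 : ∀ d → 0ℚ ℚ.< unit (suc d)
  unit>0 d = ℚₚ.positive⁻¹ (unit (suc d)) {{ℚₚ.normalize-pos 1 (suc d)}}

  ℕ-nonNeg : ∀ m → ℚ.NonNegative (+ m / 1)
  ℕ-nonNeg m = ℚₚ.normalize-nonNeg m 1

  toℚᵘ-/ : ∀ m d → ℚ.toℚᵘ (+ m / suc d) ℚᵘ.≃ mkℚᵘ (+ m) d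
  toℚᵘ-/ m d = ℚₚ.toℚᵘ-fromℚᵘ (mkℚᵘ (+ m) d)

  /-≤ : ∀ m d n e → m ℕ.* suc e ℕ.≤ n ℕ.* suc d → + m / suc d ℚ.≤ + n / suc e
  /-≤ m d n e h = ℚₚ.toℚᵘ-cancel-≤ (ℚᵘₚ.≤-respˡ-≃ (ℚᵘₚ.≃-sym (toℚᵘ-/ m d))
    (ℚᵘₚ.≤-respʳ-≃ (ℚᵘₚ.≃-sym (toℚᵘ-/ n e))
      (*≤* (subst₂ ℤ._≤_ (ℤₚ.pos-* m (suc e)) (ℤₚ.pos-* n (suc d)) (ℤ.+≤+ h)))))

  ℕ*unit : ∀ m c → (+ m / 1) ℚ.* unit (suc c) ≡ + m / suc c
  ℕ*unit m c = ℚₚ.toℚᵘ-injective (ℚᵘₚ.≃-trans (ℚₚ.toℚᵘ-homo-* (+ m / 1) (unit (suc c)))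
    (ℚᵘₚ.≃-trans (ℚᵘₚ.*-cong (toℚᵘ-/ m 0) (toℚᵘ-/ 1 c))
      (ℚᵘₚ.≃-trans (*≡* (cong₂ ℤ._*_ (ℤₚ.*-identityʳ (+ m)) (cong (λ z → + suc z) (sym (ℕₚ.+-identityʳ c)))))
        (ℚᵘₚ.≃-sym (toℚᵘ-/ m c)))))

  archimedean : ∀ δ → 0ℚ ℚ.< δ → ∃[ d ] unit (suc d) ℚ.≤ δ
  archimedean δ@(ℚ.mkℚ (+ suc n) d _) _ = d , ℚₚ.toℚᵘ-cancel-≤
    (ℚᵘₚ.≤-respˡ-≃ (ℚᵘₚ.≃-sym (toℚᵘ-/ 1 d))
      (*≤* (ℤ.+≤+ (ℕₚ.*-monoˡ-≤ (suc d) (ℕ.s≤s (ℕ.z≤n {n}))))))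
  archimedean (ℚ.mkℚ (+ zero) d _) (ℚ.*<* (ℤ.+<+ ()))
  archimedean (ℚ.mkℚ (ℤ.-[1+ n ]) d _) (ℚ.*<* ())

  *-pos : ∀ {p q} → 0ℚ ℚ.< p → 0ℚ ℚ.< q → 0ℚ ℚ.< p ℚ.* q
  *-pos {p} {q} p>0 q>0 = subst (ℚ._< p ℚ.* q) (ℚₚ.*-zeroʳ p)
    (ℚₚ.*-monoʳ-<-pos p {{ℚ.positive p>0}} q>0)

fromℚ : ℚ → ℝ
fromℚ q = mkℝ (λ _ → q) (λ δ δ>0 → 0 , λ _ _ _ _ → ≤-self+ q (ℚₚ.<⇒≤ δ>0))

fromℕ : ℕ → ℝ
fromℕ m = fromℚ (+ m / 1)

0ℝ : ℝ
0ℝ = fromℕ 0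

1ℝ : ℝ
1ℝ = fromℕ 1

infixl 6 _+ℝ_
infixl 7 _·_

_+ℝ_ : ℝ → ℝ → ℝ
x +ℝ y = mkℝ (λ i → approx x i ℚ.+ approx y i) λ δ δ>0 →
  let ½δ>0  = *-pos (unit>0 1) δ>0
      (M , p) = cauchy x (ℚ.½ ℚ.* δ) ½δ>0
      (N , q) = cauchy y (ℚ.½ ℚ.* δ) ½δ>0
  in M ℕ.⊔ N , λ i j hi hj → ℚₚ.≤-trans
       (ℚₚ.+-mono-≤ (p i j (ℕₚ.m⊔n≤o⇒m≤o M N hi) (ℕₚ.m⊔n≤o⇒m≤o M N hj))
                    (q i j (ℕₚ.m⊔n≤o⇒n≤o M N hi) (ℕₚ.m⊔n≤o⇒n≤o M N hj)))
       (ℚₚ.≤-reflexive (trans (+-interchange (approx x j) (ℚ.½ ℚ.* δ) (approx y j) (ℚ.½ ℚ.* δ))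
         (cong (approx x j ℚ.+ approx y j ℚ.+_)
           (trans (sym (ℚₚ.*-distribʳ-+ δ ℚ.½ ℚ.½)) (ℚₚ.*-identityˡ δ)))))

_·_ : ℕ → ℝ → ℝ
m · x = mkℝ (λ i → (+ m / 1) ℚ.* approx x i) λ δ δ>0 →
  let (N , p) = cauchy x (unit (suc m) ℚ.* δ) (*-pos (unit>0 m) δ>0)
  in N , λ i j hi hj → ℚₚ.≤-trans
       (ℚₚ.*-monoˡ-≤-nonNeg (+ m / 1) {{ℕ-nonNeg m}} (p i j hi hj))
       (ℚₚ.≤-trans (ℚₚ.≤-reflexive (ℚₚ.*-distribˡ-+ (+ m / 1) (approx x j) _))
         (ℚₚ.+-monoʳ-≤ ((+ m / 1) ℚ.* approx x j) (shrink δ δ>0)))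
  where
  shrink : ∀ δ → 0ℚ ℚ.< δ → (+ m / 1) ℚ.* (unit (suc m) ℚ.* δ) ℚ.≤ δ
  shrink δ δ>0 = ℚₚ.≤-trans
    (ℚₚ.≤-reflexive (trans (sym (ℚₚ.*-assoc (+ m / 1) _ δ)) (cong (ℚ._* δ) (ℕ*unit m m))))
    (ℚₚ.≤-trans
      (ℚₚ.*-monoʳ-≤-nonNeg δ {{ℚ.nonNegative (ℚₚ.<⇒≤ δ>0)}}
        (/-≤ m m 1 0 (subst₂ ℕ._≤_ (sym (ℕₚ.*-identityʳ m)) (sym (ℕₚ.*-identityˡ (suc m))) (ℕₚ.n≤1+n m))))
      (ℚₚ.≤-reflexive (ℚₚ.*-identityˡ δ)))

------------------------------------------------------------------------
-- The natural logarithm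

∑< : ℕ → (ℕ → ℚ) → ℚ
∑< zero    f = 0ℚ
∑< (suc m) f = ∑< m f ℚ.+ f m

-- Lower Riemann sum of ∫₁ⁿ dx/x with m = suc i subintervals per unit
-- length: the j-th subinterval has right endpoint 1 + (j + 1)/m, so it
-- contributes (1/m) / (1 + (j + 1)/m) = 1 / (m + (j + 1)).
lnSum : ℕ → ℕ → ℚ
lnSum n i = ∑< ((n ℕ.∸ 1) ℕ.* suc i) (λ j → + 1 / (suc i ℕ.+ suc j))

private

  ∑-mono : ∀ m {f g : ℕ → ℚ} → (∀ j → j ℕ.< m → f j ℚ.≤ g j) → ∑< m f ℚ.≤ ∑< m g
  ∑-mono zero    h = ℚₚ.≤-refl
  ∑-mono (suc m) h = ℚₚ.+-mono-≤ (∑-mono m (λ j j<m → h j (ℕₚ.m<n⇒m<1+n j<m))) (h m ℕₚ.≤-refl)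

  ∑-split : ∀ m p f → ∑< (m ℕ.+ p) f ≡ ∑< m f ℚ.+ ∑< p (λ r → f (m ℕ.+ r))
  ∑-split m zero f = trans (cong (λ z → ∑< z f) (ℕₚ.+-identityʳ m)) (sym (ℚₚ.+-identityʳ _))
  ∑-split m (suc p) f = trans (cong (λ z → ∑< z f) (ℕₚ.+-suc m p))
    (trans (cong (ℚ._+ f (m ℕ.+ p)) (∑-split m p f)) (ℚₚ.+-assoc (∑< m f) _ _))

  ∑-const : ∀ m q → ∑< m (λ _ → q) ≡ (+ m / 1) ℚ.* q
  ∑-const zero    q = sym (ℚₚ.*-zeroˡ q)
  ∑-const (suc m) q = trans (cong (ℚ._+ q) (∑-const m q))
    (trans (cong ((+ m / 1) ℚ.* q ℚ.+_) (sym (ℚₚ.*-identityˡ q)))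
      (trans (sym (ℚₚ.*-distribʳ-+ q (+ m / 1) 1ℚ)) (cong (ℚ._* q) suc/1)))
    where
    suc/1 : (+ m / 1) ℚ.+ 1ℚ ≡ + suc m / 1
    suc/1 = ℚₚ.toℚᵘ-injective (ℚᵘₚ.≃-trans (ℚₚ.toℚᵘ-homo-+ (+ m / 1) 1ℚ)
      (ℚᵘₚ.≃-trans (ℚᵘₚ.+-congˡ (ℚ.toℚᵘ 1ℚ) (toℚᵘ-/ m 0))
        (ℚᵘₚ.≃-trans {j = mkℚᵘ (+ suc m) 0}
          (*≡* (cong (ℤ._* + 1)
            (trans (cong (ℤ._+ + 1) (ℤₚ.*-identityʳ (+ m))) (cong +_ (ℕₚ.+-comm m 1)))))
          (ℚᵘₚ.≃-sym (toℚᵘ-/ (suc m) 0)))))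

  ∑-blocks : ∀ m p (f : ℕ → ℚ) → ∑< (m ℕ.* p) f ≡ ∑< m (λ j → ∑< p (λ r → f (j ℕ.* p ℕ.+ r)))
  ∑-blocks zero    p f = refl
  ∑-blocks (suc m) p f = trans (cong (λ z → ∑< z f) (ℕₚ.+-comm p (m ℕ.* p)))
    (trans (∑-split (m ℕ.* p) p f) (cong (ℚ._+ ∑< p (λ r → f (m ℕ.* p ℕ.+ r))) (∑-blocks m p f)))

  -- p equal pieces of size 1/(c p) add up to 1/c
  ∑-unit : ∀ c p → ∑< (suc p) (λ _ → unit (suc c ℕ.* suc p)) ≡ unit (suc c)
  ∑-unit c p = trans (∑-const (suc p) _) (trans (ℕ*unit (suc p) _)
    (ℚₚ.≤-antisym
      (/-≤ (suc p) _ 1 c (ℕₚ.≤-reflexive (trans (ℕₚ.*-comm (suc p) (suc c)) (sym (ℕₚ.*-identityˡ _)))))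
      (/-≤ 1 c (suc p) _ (ℕₚ.≤-reflexive (trans (ℕₚ.*-identityˡ _) (ℕₚ.*-comm (suc c) (suc p)))))))

  unit-anti : ∀ {c d} → c ℕ.≤ d → unit (suc d) ℚ.≤ unit (suc c)
  unit-anti {c} {d} c≤d = /-≤ 1 d 1 c (ℕₚ.*-monoʳ-≤ 1 (ℕ.s≤s c≤d))

  unit-anti′ : ∀ c d .{{_ : ℕ.NonZero c}} .{{_ : ℕ.NonZero d}} → c ℕ.≤ d → unit d ℚ.≤ unit c
  unit-anti′ (suc c) (suc d) (ℕ.s≤s c≤d) = unit-anti c≤d

  module Refine (n i p : ℕ) where

    m P : ℕ
    m = suc i
    P = suc p

    -- suc (fine) = m * P
    fine : ℕ
    fine = p ℕ.+ i ℕ.* P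

    M : ℕ
    M = n ℕ.∸ 1

    fineSum : lnSum n fine ≡
      ∑< (M ℕ.* m) (λ j → ∑< P (λ r → unit (suc fine ℕ.+ suc (j ℕ.* P ℕ.+ r))))
    fineSum = trans (cong (λ z → ∑< z (λ j → unit (suc fine ℕ.+ suc j))) (sym (ℕₚ.*-assoc M m P)))
      (∑-blocks (M ℕ.* m) P _)

    shift : ∀ j r → suc fine ℕ.+ suc (j ℕ.* P ℕ.+ r) ≡ (m ℕ.+ j) ℕ.* P ℕ.+ suc r
    shift j r = trans (cong (suc fine ℕ.+_) (sym (ℕₚ.+-suc (j ℕ.* P) r)))
      (trans (sym (ℕₚ.+-assoc (suc fine) (j ℕ.* P) (suc r)))
        (cong (ℕ._+ suc r) (sym (ℕₚ.*-distribʳ-+ P m j))))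

    lower : lnSum n i ℚ.≤ lnSum n fine
    lower = subst (lnSum n i ℚ.≤_) (sym fineSum) (∑-mono (M ℕ.* m) λ j _ →
      ℚₚ.≤-trans (ℚₚ.≤-reflexive (sym (∑-unit (i ℕ.+ suc j) p)))
        (∑-mono P λ r r<P → unit-anti′ (suc fine ℕ.+ suc (j ℕ.* P ℕ.+ r)) _ (le j r r<P)))
      where
      le : ∀ j r → r ℕ.< P → suc fine ℕ.+ suc (j ℕ.* P ℕ.+ r) ℕ.≤ (m ℕ.+ suc j) ℕ.* P
      le j r r<P = ℕₚ.≤-trans (ℕₚ.≤-reflexive (shift j r))
        (ℕₚ.≤-trans (ℕₚ.+-monoʳ-≤ ((m ℕ.+ j) ℕ.* P) r<P)
          (ℕₚ.≤-reflexive (trans (ℕₚ.+-comm _ P) (cong (ℕ._* P) (sym (ℕₚ.+-suc m j))))))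

    upper : lnSum n fine ℚ.≤ ∑< (M ℕ.* m) (λ j → unit (m ℕ.+ j))
    upper = subst (ℚ._≤ ∑< (M ℕ.* m) (λ j → unit (m ℕ.+ j))) (sym fineSum) (∑-mono (M ℕ.* m) λ j _ →
      ℚₚ.≤-trans
        (∑-mono P λ r r<P → unit-anti′ _ (suc fine ℕ.+ suc (j ℕ.* P ℕ.+ r))
          (ℕₚ.≤-trans (ℕₚ.m≤m+n ((m ℕ.+ j) ℕ.* P) (suc r)) (ℕₚ.≤-reflexive (sym (shift j r)))))
        (ℚₚ.≤-reflexive (∑-unit (i ℕ.+ j) p)))

  -- upper and lower Riemann sums differ by at most 1/m
  upper≤lower+ : ∀ i K → ∑< K (λ j → unit (suc i ℕ.+ j)) ℚ.+ unit (suc i ℕ.+ K)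
                 ≡ ∑< K (λ j → unit (suc i ℕ.+ suc j)) ℚ.+ unit (suc i)
  upper≤lower+ i zero    = cong (λ z → 0ℚ ℚ.+ unit (suc z)) (ℕₚ.+-identityʳ i)
  upper≤lower+ i (suc K) = trans (cong (ℚ._+ unit (suc i ℕ.+ suc K)) (upper≤lower+ i K))
    (+-swap (∑< K (λ j → unit (suc i ℕ.+ suc j))) (unit (suc i)) (unit (suc i ℕ.+ suc K)))

  lnSum-cauchy : ∀ n → IsCauchy (lnSum n)
  lnSum-cauchy n δ δ>0 with archimedean δ δ>0
  ... | d , 1/d≤δ = d , λ i j _ d≤j → begin
    lnSum n i                                               ≤⟨ Refine.lower n i j ⟩
    lnSum n (j ℕ.+ i ℕ.* suc j)                             ≡⟨ cong (lnSum n) (common i j) ⟩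
    lnSum n (i ℕ.+ j ℕ.* suc i)                             ≤⟨ Refine.upper n j i ⟩
    ∑< (K j) (λ l → unit (suc j ℕ.+ l))                     ≤⟨ ≤-self+ _ (ℚₚ.<⇒≤ (unit>0 (j ℕ.+ K j))) ⟩
    ∑< (K j) (λ l → unit (suc j ℕ.+ l)) ℚ.+ unit (suc j ℕ.+ K j)
                                                            ≡⟨ upper≤lower+ j (K j) ⟩
    lnSum n j ℚ.+ unit (suc j)                              ≤⟨ ℚₚ.+-monoʳ-≤ (lnSum n j) (ℚₚ.≤-trans (unit-anti d≤j) 1/d≤δ) ⟩
    lnSum n j ℚ.+ δ                                         ∎
    where
    open ℚₚ.≤-Reasoning
    K : ℕ → ℕ
    K j = (n ℕ.∸ 1) ℕ.* suc j
    common : ∀ i j → j ℕ.+ i ℕ.* suc j ≡ i ℕ.+ j ℕ.* suc i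
    common i j = ℕₚ.suc-injective (ℕₚ.*-comm (suc i) (suc j))

-- ln n = ∫₁ⁿ dx/x for n ≥ 1; the value ln 0 = 0 is junk.
ln : ℕ → ℝ
ln n = mkℝ (lnSum n) (lnSum-cauchy n)

------------------------------------------------------------------------
-- Asymptotics

Eventually : (ℕ → Set) → Set
Eventually P = ∃[ N ] ∀ n → N ℕ.≤ n → P n

-- f = o(n), with 1/c in the role of the small constant: f(n) ≤ n / c.
_=o[n] : (ℕ → ℕ) → Set
f =o[n] = ∀ c → Eventually λ n → c ℕ.* f n ℕ.≤ n

_≤√_ : ℕ → ℕ → Set
m ≤√ n = m ℕ.* m ℕ.≤ n

-- f = o(√n), likewise: f(n) ≤ √n / c.
_=o[√n] : (ℕ → ℕ) → Set
f =o[√n] = ∀ c → Eventually λ n → (c ℕ.* f n) ≤√ n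

------------------------------------------------------------------------
-- (a : b) Maker-Breaker games on a board E, Breaker moving first.
-- MakerWins is evaluated on the list of all elements claimed by Maker.

module MakerBreaker {E : Set} (a b : ℕ) (MakerWins : List E → Set) where

  Move : Set
  Move = List E

  -- Completed rounds, most recent first; each is a move of Breaker
  -- followed by a move of Maker.
  History : Set
  History = List (Move × Move)

  breakerClaimed makerClaimed claimed : History → List E
  breakerClaimed h = concatMap proj₁ h
  makerClaimed   h = concatMap proj₂ h
  claimed        h = breakerClaimed h ++ makerClaimed h

  -- L is a legal move of a player who has to claim q elements when the
  -- elements of C are already taken.
  record Legal (q : ℕ) (C : List E) (L : Move) : Set where
    field
      distinct  : Unique L
      unclaimed : Disjoint L C
      quota     : length L ≡ q ⊎ (length L ℕ.< q × (∀ e → e ∈ L ++ C))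

  Finished : History → Set
  Finished h = ∀ e → e ∈ claimed h

  -- Breaker's move as a function of the course of the game so far.
  Strategy : Set
  Strategy = History → Move

  -- Histories that can arise when Breaker follows σ and Maker plays legally.
  data Consistent (σ : Strategy) : History → Set where
    start : Consistent σ []
    round : ∀ {h L} → Consistent σ h → Legal a (σ h ++ claimed h) L →
            Consistent σ ((σ h , L) ∷ h)

  Winning : Strategy → Set
  Winning σ = ∀ h → Consistent σ h →
    Legal b (claimed h) (σ h) × (Finished h → ¬ MakerWins (makerClaimed h))

  BreakerHasWinningStrategy : Set
  BreakerHasWinningStrategy = ∃ Winning

------------------------------------------------------------------------
-- The minimum-degree-k game on Kₙ

Edge : ℕ → Set
Edge n = ∃₂ λ (u v : Fin n) → u Fin.< v

Incident : ∀ {n} → Fin n → Edge n → Set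
Incident w (u , v , _) = w ≡ u ⊎ w ≡ v

incident? : ∀ {n} (w : Fin n) (e : Edge n) → Dec (Incident w e)
incident? w (u , v , _) = (w Finₚ.≟ u) ⊎-dec (w Finₚ.≟ v)

-- Degree in the graph with the given edges, which are assumed distinct.
degree : ∀ {n} → List (Edge n) → Fin n → ℕ
degree es w = length (filter (incident? w) es)

MinDegree≥ : ∀ {n} → ℕ → List (Edge n) → Set
MinDegree≥ k es = ∀ w → k ℕ.≤ degree es w

BreakerWinsMinDegreeGame : (n a b k : ℕ) → Set
BreakerWinsMinDegreeGame n a b k =
  MakerBreaker.BreakerHasWinningStrategy {Edge n} a b (MinDegree≥ k)

{-# OPTIONS --safe #-}

-- As k ≥ 1, it is enough that Breaker claims all edges at one vertex.  If
-- b ≥ n he does so at once.  Otherwise the bias condition forces a = O(ln n),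
-- so for a small constant δ > 0 some T of order at least n^(1 - δ) satisfies
-- 16 a² T ≤ b.  Breaker fixes c = 3aT + 1 vertices and claims all edges among
-- them; this takes at most T rounds, as c² ≤ T b, and Maker touches at most 2a
-- of the vertices per round, so more than aT of them stay untouched.  The
-- edges leaving these form disjoint boxes, of which Maker now touches at most
-- a per round: with aj + 1 boxes left, Breaker takes ⌊b / (aj + 1)⌋ edges from
-- each, for j = T, …, 1, and in the end b edges from the last one.  So he wins
-- if n ≤ b + Σ_{j=1}^T ⌊b / (aj + 1)⌋, and the right-hand side is at least
-- (b / a) (a + H_T - 1) - T, where H_T ≥ (1 - δ) ln n.

module Submission where

open import Data.Fin.Base as Fin using (Fin)
import Data.Fin.Properties as Finₚ
open import Data.Integer.Base as ℤ using (+_)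
import Data.Integer.Properties as ℤₚ
open import Data.List.Base
  using (List; []; _∷_; _++_; concatMap; length; filter; take; drop; mapMaybe; allFin; deduplicate)
import Data.List.Membership.DecPropositional as DecMembership
open import Data.List.Membership.Propositional using (_∈_; _∉_)
open import Data.List.Membership.Propositional.Properties
  using (∈-++⁺ˡ; ∈-++⁺ʳ; ∈-++⁻; ∈-filter⁺; ∈-filter⁻; ∈-deduplicate⁺; ∈-concatMap⁺; ∈-allFin)
open import Data.List.Properties
  using (length-++; ++-assoc; length-take; length-drop; length-mapMaybe; length-tabulate; ≡-dec;
         take++drop≡id; filter-none; length-filter; length-deduplicate; take-all)
open import Data.List.Relation.Unary.All as All using ([]; _∷_)
open import Data.List.Relation.Unary.AllPairs using ([]; _∷_)
open import Data.List.Relation.Unary.Any as Any using (here; there)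
import Data.List.Relation.Unary.Unique.DecPropositional as DecUnique
import Data.List.Relation.Unary.Unique.DecPropositional.Properties as DecUniqueₚ
open import Data.List.Relation.Unary.Unique.Propositional using (Unique)
open import Data.List.Relation.Unary.Unique.Propositional.Properties as Uniqueₚ using (allFin⁺)
open import Data.Maybe.Base as Maybe using (Maybe; just; nothing)
open import Data.Nat.Base
open import Data.Nat.Divisibility using (∣-trans; m∣m*n; divides-refl; m≤n⇒m!∣n!)
open import Data.Nat.DivMod
open import Data.Nat.Properties
open import Data.Nat.Tactic.RingSolver using (solve-∀)
open import Data.Product.Base using (∃-syntax; _×_; _,_; proj₁; proj₂)
open import Data.Rational.Base as ℚ using (ℚ; 0ℚ)
import Data.Rational.Properties as ℚₚ
open import Data.Rational.Unnormalised.Base as ℚᵘ using (mkℚᵘ; *≤*)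
import Data.Rational.Unnormalised.Properties as ℚᵘₚ
open import Data.Sum.Base using (_⊎_; inj₁; inj₂; [_,_]′)
open import Function.Base using (_∘_; case_of_)
open import Relation.Binary.Definitions using (DecidableEquality; tri<; tri≈; tri>)
open import Relation.Binary.PropositionalEquality
open import Relation.Nullary.Decidable using (Dec; yes; no; ¬?; map′; _×-dec_; _⊎-dec_)
open import Relation.Nullary.Negation using (¬_; contradiction)
open import Defs

-- Breaker's strategy

length-concatMap-≤ : ∀ {A B : Set} {f : A → List B} {m} → (∀ x → length (f x) ≤ m) →
                     ∀ xs → length (concatMap f xs) ≤ length xs * m
length-concatMap-≤ h []       = z≤n
length-concatMap-≤ {f = f} h (x ∷ xs) =
  ≤-trans (≤-reflexive (length-++ (f x))) (+-mono-≤ (h x) (length-concatMap-≤ h xs))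

∈-take-drop : ∀ {A : Set} {x : A} m xs → x ∈ xs → x ∈ take m xs ⊎ x ∈ drop m xs
∈-take-drop {x = x} m xs x∈ = ∈-++⁻ (take m xs) (subst (x ∈_) (sym (take++drop≡id m xs)) x∈)

∈-take⁻ : ∀ {A : Set} {x : A} m {xs} → x ∈ take m xs → x ∈ xs
∈-take⁻ {x = x} m {xs} x∈ = subst (x ∈_) (take++drop≡id m xs) (∈-++⁺ˡ x∈)

length-take-≤ : ∀ {A : Set} m (xs : List A) → length (take m xs) ≤ m
length-take-≤ m xs = ≤-trans (≤-reflexive (length-take m xs)) (m⊓n≤m m _)

length-partition : ∀ {A : Set} {P : A → Set} (P? : ∀ x → Dec (P x)) xs →
  length xs ≡ length (filter P? xs) + length (filter (λ x → ¬? (P? x)) xs)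
length-partition P? []       = refl
length-partition P? (x ∷ xs) with P? x
... | yes _ = cong suc (length-partition P? xs)
... | no  _ = trans (cong suc (length-partition P? xs)) (sym (+-suc _ _))

-- What a box that survives to the end has lost before the last move: with `a * j + 1` boxes left,
-- Breaker can afford `b / suc (a * j)` edges from each, and `j` runs from `T` down to 1.
boxSum : ℕ → ℕ → ℕ → ℕ
boxSum a b zero    = 0
boxSum a b (suc T) = boxSum a b T + b / suc (a * suc T)

-- Edges of the complete graph and vertices untouched by Maker

module _ {n : ℕ} where

  _≟ᴱ_ : DecidableEquality (Edge n)
  (u , v , p) ≟ᴱ (u′ , v′ , p′) with u Finₚ.≟ u′ | v Finₚ.≟ v′
  ... | no  u≢  | _        = no λ { refl → u≢ refl }
  ... | yes _   | no v≢    = no λ { refl → v≢ refl }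
  ... | yes refl | yes refl = yes (cong (λ q → u , v , q) (Finₚ.<-irrelevant p p′))

  open DecMembership _≟ᴱ_ using (_∈?_; _∉?_)

  link : Fin n → Fin n → Maybe (Edge n)
  link u v with Finₚ.<-cmp u v
  ... | tri< u<v _ _ = just (u , v , u<v)
  ... | tri≈ _ _ _   = nothing
  ... | tri> _ _ v<u = just (v , u , v<u)

  link-< : ∀ {u v} (u<v : u Fin.< v) → link u v ≡ just (u , v , u<v)
  link-< {u} {v} u<v with Finₚ.<-cmp u v
  ... | tri< p _ _ = cong (λ q → just (u , v , q)) (Finₚ.<-irrelevant p u<v)
  ... | tri≈ ≮ _ _ = contradiction u<v ≮
  ... | tri> ≮ _ _ = contradiction u<v ≮

  link-> : ∀ {u v} (u<v : u Fin.< v) → link v u ≡ just (u , v , u<v)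
  link-> {u} {v} u<v with Finₚ.<-cmp v u
  ... | tri< _ _ ≯ = contradiction u<v ≯
  ... | tri≈ _ _ ≯ = contradiction u<v ≯
  ... | tri> _ _ p = cong (λ q → just (u , v , q)) (Finₚ.<-irrelevant p u<v)

  ∈-mapMaybe : ∀ {A B : Set} {f : A → Maybe B} {x y} {xs} → x ∈ xs → f x ≡ just y → y ∈ mapMaybe f xs
  ∈-mapMaybe {f = f} {x} (here refl) eq with f x | eq
  ... | just _ | refl = here refl
  ∈-mapMaybe {f = f} {xs = z ∷ _} (there x∈) eq with f z
  ... | just _  = there (∈-mapMaybe x∈ eq)
  ... | nothing = ∈-mapMaybe x∈ eq

  edgesTo : List (Fin n) → Fin n → List (Edge n)
  edgesTo vs u = mapMaybe (link u) vs

  star : Fin n → List (Edge n)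
  star = edgesTo (allFin n)

  ∈-star : ∀ {w e} → Incident w e → e ∈ star w
  ∈-star {e = u , v , u<v} (inj₁ refl) = ∈-mapMaybe (∈-allFin v) (link-< u<v)
  ∈-star {e = u , v , u<v} (inj₂ refl) = ∈-mapMaybe (∈-allFin u) (link-> u<v)

  length-star : ∀ w → length (star w) ≤ n
  length-star w = ≤-trans (length-mapMaybe (link w) (allFin n)) (≤-reflexive (length-tabulate {n = n} (λ i → i)))

  Within : List (Fin n) → Edge n → Set
  Within A (u , v , _) = u ∈ A × v ∈ A

  -- For duplicate-free `A` each edge is listed twice, once from either end; `legal-superset`
  -- tolerates repetitions, and the bound |A|² counts them.
  inside : List (Fin n) → List (Edge n)
  inside A = concatMap (edgesTo A) A

  ∈-inside : ∀ {A e} → Within A e → e ∈ inside A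
  ∈-inside {A} {u , v , u<v} (u∈ , v∈) =
    ∈-concatMap⁺ (edgesTo A) (Any.map (λ { refl → ∈-mapMaybe v∈ (link-< u<v) }) u∈)

  length-inside : ∀ A → length (inside A) ≤ length A * length A
  length-inside A = length-concatMap-≤ (λ u → length-mapMaybe (link u) A) A

  allEdges : List (Edge n)
  allEdges = inside (allFin n)

  ∈-allEdges : ∀ e → e ∈ allEdges
  ∈-allEdges (u , v , _) = ∈-inside (∈-allFin u , ∈-allFin v)

  Clear : List (Edge n) → Fin n → Set
  Clear M w = ∀ e → Incident w e → e ∉ M

  clear⇒degree≡0 : ∀ {M w} → Clear M w → degree M w ≡ 0
  clear⇒degree≡0 {M} {w} c = cong length
    (filter-none (incident? w) {xs = M} (All.tabulate λ {e} e∈ i → c e i e∈))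

  surviving : List (Edge n) → List (Fin n) → List (Fin n)
  surviving []       A = A
  surviving (e ∷ es) A = surviving es (filter (λ w → ¬? (incident? w e)) A)

  surviving-! : ∀ es {A} → Unique A → Unique (surviving es A)
  surviving-! []       A! = A!
  surviving-! (e ∷ es) A! = surviving-! es (Uniqueₚ.filter⁺ _ A!)

  ∈-surviving : ∀ es {A w} → w ∈ surviving es A → w ∈ A × Clear es w
  ∈-surviving []       w∈ = w∈ , λ _ _ ()
  ∈-surviving (e ∷ es) w∈ with ∈-surviving es w∈
  ... | w∈′ , c with ∈-filter⁻ (λ w → ¬? (incident? w e)) w∈′
  ... | w∈A , ¬i = w∈A , λ { _ i (here refl) → ¬i i ; f i (there f∈) → c f i f∈ }

  -- Each edge of `es` removes at most `d` vertices. The hypothesis speaks of all duplicate-free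
  -- lists of vertices of `A` on `e`, so that it passes to the filtered set `A′` in the induction.
  length-surviving : ∀ d es {A} → Unique A →
    (∀ {e xs} → e ∈ es → Unique xs → (∀ {x} → x ∈ xs → x ∈ A × Incident x e) → length xs ≤ d) →
    length A ≤ length es * d + length (surviving es A)
  length-surviving d []       A! h = ≤-refl
  length-surviving d (e ∷ es) {A} A! h = begin
    length A                                                     ≡⟨ length-partition (λ w → incident? w e) A ⟩
    length (filter (λ w → incident? w e) A) + length A′
      ≤⟨ +-mono-≤ (h (here refl) (Uniqueₚ.filter⁺ _ A!) (∈-filter⁻ (λ w → incident? w e)))
                  (length-surviving d es (Uniqueₚ.filter⁺ _ A!)
                    λ e∈ xs! xs⊆ → h (there e∈) xs! λ x∈ →
                      proj₁ (∈-filter⁻ (λ w → ¬? (incident? w e)) (proj₁ (xs⊆ x∈))) , proj₂ (xs⊆ x∈)) ⟩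
    d + (length es * d + length (surviving es A′))               ≡⟨ +-assoc d _ _ ⟨
    d + length es * d + length (surviving es A′)                 ∎
    where
    open ≤-Reasoning
    A′ : List (Fin n)
    A′ = filter (λ w → ¬? (incident? w e)) A

  ≤2-incident : ∀ {e : Edge n} {xs} → Unique xs → (∀ {x} → x ∈ xs → Incident x e) → length xs ≤ 2
  ≤2-incident {xs = []}          _ _ = z≤n
  ≤2-incident {xs = _ ∷ []}      _ _ = s≤s z≤n
  ≤2-incident {xs = _ ∷ _ ∷ []}  _ _ = ≤-refl
  ≤2-incident {xs = x ∷ y ∷ z ∷ _} ((x≢y ∷ x≢z ∷ _) ∷ (y≢z ∷ _) ∷ _) h
    with h (here refl) | h (there (here refl)) | h (there (there (here refl)))
  ... | inj₁ p | inj₁ q | _      = contradiction (trans p (sym q)) x≢y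
  ... | inj₂ p | inj₂ q | _      = contradiction (trans p (sym q)) x≢y
  ... | inj₁ p | _      | inj₁ q = contradiction (trans p (sym q)) x≢z
  ... | inj₂ p | _      | inj₂ q = contradiction (trans p (sym q)) x≢z
  ... | _      | inj₁ p | inj₁ q = contradiction (trans p (sym q)) y≢z
  ... | _      | inj₂ p | inj₂ q = contradiction (trans p (sym q)) y≢z

  -- Two distinct vertices of `A` on `e` would be its two ends. This is what owning the clique buys:
  -- an edge of Maker then touches only one box.
  ≤1-incident : ∀ {e : Edge n} {A xs} → ¬ Within A e → Unique xs →
                (∀ {x} → x ∈ xs → x ∈ A × Incident x e) → length xs ≤ 1
  ≤1-incident {xs = []}     _ _ _ = z≤n
  ≤1-incident {xs = _ ∷ []} _ _ _ = ≤-refl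
  ≤1-incident {xs = x ∷ y ∷ _} ¬in ((x≢y ∷ _) ∷ _) h
    with h (here refl) | h (there (here refl))
  ... | _   , inj₁ p    | _   , inj₁ q    = contradiction (trans p (sym q)) x≢y
  ... | _   , inj₂ p    | _   , inj₂ q    = contradiction (trans p (sym q)) x≢y
  ... | x∈  , inj₁ refl | y∈  , inj₂ refl = contradiction (x∈ , y∈) ¬in
  ... | x∈  , inj₂ refl | y∈  , inj₁ refl = contradiction (y∈ , x∈) ¬in

-- Winning positions and the strategy read off from them

module Play (n a b k : ℕ) (k>0 : 0 < k) where

  open MakerBreaker {Edge n} a b (MinDegree≥ k)
  open DecMembership (_≟ᴱ_ {n}) using (_∈?_; _∉?_)
  open DecUnique (_≟ᴱ_ {n}) using (unique?)
  open Legal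

  -- A strategy is defined on all histories, so it has to test whether a recorded reply of Maker was
  -- legal before following it.
  legal? : ∀ q C L → Dec (Legal q C L)
  legal? q C L = map′ (λ (u , d , l) → record { distinct = u ; unclaimed = λ (x , y) → All.lookup d x y ; quota = l })
    (λ l → distinct l , All.tabulate (λ x y → unclaimed l (x , y)) , quota l)
    (unique? L ×-dec All.all? (_∉? C) L ×-dec
      ((length L ≟ q) ⊎-dec ((length L <? q) ×-dec
        map′ (λ h e → All.lookup h (∈-allEdges e)) (λ h → All.tabulate λ {e} _ → h e)
          (All.all? (_∈? (L ++ C)) allEdges))))

  legal-length : ∀ {q C L} → Legal q C L → length L ≤ q
  legal-length l = [ ≤-reflexive , <⇒≤ ∘ proj₁ ]′ (quota l)

  -- Lets Breaker plan with a wish list `W` that may contain repetitions and taken edges: these are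
  -- removed, and arbitrary free edges fill up the quota.
  legal-superset : ∀ q C W → length W ≤ q → ∃[ L ] Legal q C L × (∀ {e} → e ∈ W → e ∈ L ⊎ e ∈ C)
  legal-superset q C W |W|≤q = W′ ++ F , record
    { distinct  = Uniqueₚ.++⁺ (Uniqueₚ.filter⁺ _ (deduplicate-! W)) (Uniqueₚ.take⁺ _ (Uniqueₚ.filter⁺ _ (deduplicate-! allEdges)))
                    λ (e∈W′ , e∈F) → F⊆ e∈F (∈-++⁺ˡ e∈W′)
    ; unclaimed = λ (e∈ , e∈C) → [ (λ e∈W′ → proj₂ (∈-filter⁻ (_∉? C) {xs = deduplicate _≟ᴱ_ W} e∈W′) e∈C)
                                 , (λ e∈F → F⊆ e∈F (∈-++⁺ʳ W′ e∈C)) ]′ (∈-++⁻ W′ e∈)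
    ; quota     = full
    } , covered
    where
    open DecUniqueₚ (_≟ᴱ_ {n}) using (deduplicate-!)
    W′ R F : List (Edge n)
    W′ = filter (_∉? C) (deduplicate _≟ᴱ_ W)
    R  = filter (_∉? (W′ ++ C)) (deduplicate _≟ᴱ_ allEdges)
    F  = take (q ∸ length W′) R
    |W′|≤q : length W′ ≤ q
    |W′|≤q = ≤-trans (length-filter (_∉? C) (deduplicate _≟ᴱ_ W)) (≤-trans (length-deduplicate _≟ᴱ_ W) |W|≤q)
    F⊆ : ∀ {e} → e ∈ F → e ∉ W′ ++ C
    F⊆ e∈F = proj₂ (∈-filter⁻ (_∉? (W′ ++ C)) {xs = deduplicate _≟ᴱ_ allEdges} (∈-take⁻ _ e∈F))
    covered : ∀ {e} → e ∈ W → e ∈ W′ ++ F ⊎ e ∈ C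
    covered {e} e∈W with e ∈? C
    ... | yes e∈C = inj₂ e∈C
    ... | no  e∉C = inj₁ (∈-++⁺ˡ (∈-filter⁺ (_∉? C) (∈-deduplicate⁺ _≟ᴱ_ e∈W) e∉C))
    full : length (W′ ++ F) ≡ q ⊎ (length (W′ ++ F) < q × (∀ e → e ∈ (W′ ++ F) ++ C))
    full with q ∸ length W′ ≤? length R
    ... | yes q≤ = inj₁ (trans (length-++ W′) (trans (cong (λ z → length W′ + z) (trans (length-take _ R) (m≤n⇒m⊓n≡m q≤)))
                     (m+[n∸m]≡n |W′|≤q)))
    -- Too few free edges remain to fill the quota, so all of `R` is taken and the board is
    -- exhausted.
    ... | no  q≰ = inj₂
      ( <-≤-trans (subst (_< length W′ + (q ∸ length W′))
                     (sym (trans (length-++ W′) (cong (λ z → length W′ + length z) F≡R)))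
                     (+-monoʳ-< (length W′) (≰⇒> q≰)))
                  (≤-reflexive (m+[n∸m]≡n |W′|≤q))
      , λ e → case e ∈? (W′ ++ C) of λ
          { (yes e∈) → [ ∈-++⁺ˡ ∘ ∈-++⁺ˡ , ∈-++⁺ʳ (W′ ++ F) ]′ (∈-++⁻ W′ e∈)
          ; (no e∉)  → ∈-++⁺ˡ (∈-++⁺ʳ W′ (subst (e ∈_) (sym F≡R)
                         (∈-filter⁺ (_∉? (W′ ++ C)) (∈-deduplicate⁺ _≟ᴱ_ (∈-allEdges e)) e∉))) })
      where
      F≡R : F ≡ R
      F≡R = take-all _ R (<⇒≤ (≰⇒> q≰))

  -- A well-founded game tree certifying a win for Breaker, who is to move. `isolated` can be a leaf
  -- because the degree of `w` in Maker's graph stays 0 under legal play.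
  data Wins (B M : List (Edge n)) : Set where
    isolated : ∀ w → (∀ e → Incident w e → e ∈ B) → Clear M w → Wins B M
    play     : ∀ L → Legal b (B ++ M) L →
               (∀ L′ → Legal a (L ++ B ++ M) L′ → Wins (L ++ B) (L′ ++ M)) → Wins B M

  clear-++ : ∀ {w} {L′ M : List (Edge n)} → Clear L′ w → Clear M w → Clear (L′ ++ M) w
  clear-++ {L′ = L′} c c′ e i e∈ = [ c e i , c′ e i ]′ (∈-++⁻ L′ e∈)

  isolated-reply : ∀ {q C L B M L′} w → (∀ e → Incident w e → e ∈ B) → Clear M w →
                   (∀ {e} → e ∈ B → e ∈ C) → Legal q C L′ → Wins (L ++ B) (L′ ++ M)
  isolated-reply {L = L} w own c B⊆C l =
    isolated w (λ e i → ∈-++⁺ʳ L (own e i)) (clear-++ (λ e i e∈ → unclaimed l (e∈ , B⊆C (own e i))) c)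

  move : ∀ {B M} → Wins B M → List (Edge n)
  move {B} {M} (isolated _ _ _) = proj₁ (legal-superset b (B ++ M) [] z≤n)
  move         (play L _ _)     = L

  move-legal : ∀ {B M} (t : Wins B M) → Legal b (B ++ M) (move t)
  move-legal {B} {M} (isolated _ _ _) = proj₁ (proj₂ (legal-superset b (B ++ M) [] z≤n))
  move-legal         (play _ l _)     = l

  -- Replays one recorded round in the tree. It fails if Maker's reply is illegal or, at a `play`
  -- node, if `K` is not the prescribed move; at a leaf any `K` keeps `w` isolated.
  advance : ∀ {B M} → Wins B M → ∀ K L′ → Maybe (Wins (K ++ B) (L′ ++ M))
  advance {B} {M} t K L′ with legal? a (K ++ B ++ M) L′
  advance t K L′ | no _ = nothing
  advance (isolated w own c) K L′ | yes l = just (isolated-reply w own c (∈-++⁺ʳ K ∘ ∈-++⁺ˡ) l)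
  advance (play L _ f) K L′ | yes l with ≡-dec _≟ᴱ_ K L
  ... | yes refl = just (f L′ l)
  ... | no _     = nothing

  advance-move : ∀ {B M} (t : Wins B M) {L′} → Legal a (move t ++ B ++ M) L′ →
                 ∃[ t′ ] advance t (move t) L′ ≡ just t′
  advance-move {B} {M} t {L′} l with legal? a (move t ++ B ++ M) L′
  advance-move t l | no ¬l = contradiction l ¬l
  advance-move (isolated w own c) l | yes _ = _ , refl
  advance-move (play L _ f) l | yes _ with ≡-dec _≟ᴱ_ L L
  ... | yes refl = _ , refl
  ... | no L≢L   = contradiction refl L≢L

  wins-finished : ∀ {B M} → Wins B M → (∀ e → e ∈ B ++ M) → ¬ MinDegree≥ k M
  wins-finished (isolated w _ c) _ deg = <⇒≱ k>0 (≤-trans (deg w) (≤-reflexive (clear⇒degree≡0 c)))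
  wins-finished (play (e ∷ L) l _) all _ = unclaimed l (here refl , all e)
  -- On a full board the prescribed legal move must be empty. Letting Maker pass too descends the
  -- tree without changing the position, until a leaf is reached.
  wins-finished (play [] _ f) all deg = wins-finished (f [] pass) all deg
    where
    pass : Legal a _ []
    pass = record { distinct = [] ; unclaimed = λ ()
                  ; quota = case a ≟ 0 of λ { (yes a≡0) → inj₁ (sym a≡0) ; (no a≢0) → inj₂ (n≢0⇒n>0 a≢0 , all) } }

  winning : Wins [] [] → BreakerHasWinningStrategy
  winning t₀ = σ , λ h c → let (t , eq) = follows c in
      subst (Legal b (claimed h)) (sym (σ-follow h eq)) (move-legal t) , wins-finished t
    where
    follow : ∀ h → Maybe (Wins (breakerClaimed h) (makerClaimed h))
    follow []             = just t₀
    follow ((K , L′) ∷ h) = Maybe._>>=_ (follow h) (λ t → advance t K L′)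
    σ : Strategy
    -- The default `[]` is used only where the replay fails; `follows` shows that this never happens
    -- on a consistent history.
    σ h = Maybe.maybe′ move [] (follow h)
    σ-follow : ∀ h {t} → follow h ≡ just t → σ h ≡ move t
    σ-follow h eq = cong (Maybe.maybe′ move []) eq
    follows : ∀ {h} → Consistent σ h → ∃[ t ] follow h ≡ just t
    follows start = t₀ , refl
    follows (round {h} {L′} c l) with follow h | follows c
    ... | just t | _ , refl = advance-move t l

  -- The clique phase and the box phase

  Owned : List (Edge n) → List (Fin n) → Set
  Owned B A = ∀ {e} → Within A e → e ∈ B

  -- `U w` only has to contain the edges at `w` that Breaker still lacks; it may also contain edges
  -- already claimed.
  Boxes : List (Edge n) → List (Fin n) → (Fin n → List (Edge n)) → ℕ → Set
  Boxes B A U s = ∀ {w} → w ∈ A → length (U w) ≤ s × (∀ {e} → Incident w e → e ∈ U w ⊎ e ∈ B)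

  AllClear : List (Edge n) → List (Fin n) → Set
  AllClear M A = ∀ {w} → w ∈ A → Clear M w

  -- The round common to both phases, with `d` the number of vertices of `A` that one edge of Maker
  -- can spoil: 2 while the clique is being claimed, 1 afterwards.
  wins-round : ∀ d {A B M} W → length W ≤ b → Unique A → AllClear M A →
    (∀ {e xs} → e ∉ B → Unique xs → (∀ {x} → x ∈ xs → x ∈ A × Incident x e) → length xs ≤ d) →
    (∀ {L L′ A′} → (∀ {w} → w ∈ A′ → w ∈ A) → Unique A′ → AllClear (L′ ++ M) A′ →
      length A ≤ a * d + length A′ →
      (∀ {w f} → w ∈ A → f ∈ W → Incident w f → f ∈ L ++ B) → Wins (L ++ B) (L′ ++ M)) →
    Wins B M
  wins-round d {A} {B} {M} W |W|≤b A! clear few next with legal-superset b (B ++ M) W |W|≤b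
  ... | L , l , W⊆ = play L l λ L′ l′ → next
    (proj₁ ∘ ∈-surviving L′)
    (surviving-! L′ A!)
    (λ w∈ → let (w∈A , c) = ∈-surviving L′ w∈ in clear-++ c (clear w∈A))
    (≤-trans
      (length-surviving d L′ A! λ e∈ → few λ e∈B → unclaimed l′ (e∈ , ∈-++⁺ʳ L (∈-++⁺ˡ e∈B)))
      (+-monoˡ-≤ _ (*-monoˡ-≤ d (legal-length l′))))
    -- A wished edge at a clear vertex cannot already be Maker's, so after the move it belongs to
    -- Breaker.
    (λ w∈A f∈W i → [ ∈-++⁺ˡ
                   , (λ f∈ → ∈-++⁺ʳ L ([ (λ f∈B → f∈B) , (λ f∈M → contradiction f∈M (clear w∈A _ i)) ]′ (∈-++⁻ B f∈)))
                   ]′ (W⊆ f∈W))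

  -- The box game by induction on the rounds before the last. Breaker keeps just `a * suc T + 1`
  -- boxes and shortens each equally; Maker spoils at most `a` of them, so more than `a * T`
  -- survive. With `T` equal to 0 one box of size at most `b` is claimed whole.
  wins-boxes : ∀ T {s A B M} (U : Fin n → List (Edge n)) →
    a * T < length A → Unique A → AllClear M A → Owned B A → Boxes B A U s → s ≤ b + boxSum a b T →
    Wins B M
  wins-boxes zero {s} {w ∷ _} {B} {M} U _ _ clear _ boxes s≤
    with legal-superset b (B ++ M) (U w) (≤-trans (proj₁ (boxes (here refl))) (≤-trans s≤ (≤-reflexive (+-identityʳ b))))
  ... | L , l , U⊆ = play L l λ L′ l′ →
    isolated w own (clear-++ (λ e i e∈ → unclaimed l′ (e∈ , subst (e ∈_) (++-assoc L B M) (∈-++⁺ˡ (own e i)))) (clear (here refl)))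
    where
    own : ∀ e → Incident w e → e ∈ L ++ B
    own e i with proj₂ (boxes (here refl)) i
    ... | inj₂ e∈B = ∈-++⁺ʳ L e∈B
    ... | inj₁ e∈U with U⊆ e∈U
    ... | inj₁ e∈L = ∈-++⁺ˡ e∈L
    ... | inj₂ e∈ = ∈-++⁺ʳ L ([ (λ e∈B → e∈B) , (λ e∈M → contradiction e∈M (clear (here refl) e i)) ]′ (∈-++⁻ B e∈))
  wins-boxes (suc T) {s} {A} {B} {M} U aT<|A| A! clear owned boxes s≤ =
    wins-round 1 W |W|≤b (Uniqueₚ.take⁺ r A!) (clear ∘ ∈-take⁻ r)
      (λ {e} e∉B xs! xs⊆ → ≤1-incident {e = e} (λ (u∈ , v∈) → e∉B (owned (∈-take⁻ r u∈ , ∈-take⁻ r v∈))) xs! xs⊆)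
      λ {L} {L′} {A′} A′⊆ A′! clear′ |A₀|≤ W⊆ → wins-boxes T (drop q ∘ U)
        -- The kept boxes number `a + a * T + 1`; cancelling the `a` that Maker can spoil leaves the
        -- bound for the next round.
        (+-cancelˡ-< a _ _ (<-≤-trans
          (subst₂ _<_ (*-suc a T) (sym |A₀|≡) (n<1+n (a * suc T)))
          (≤-trans |A₀|≤ (≤-reflexive (cong (_+ _) (*-identityʳ a))))))
        A′! clear′
        (λ (u∈ , v∈) → ∈-++⁺ʳ L (owned (∈-take⁻ r (A′⊆ u∈) , ∈-take⁻ r (A′⊆ v∈))))
        (λ {w} w∈ → let (|U|≤ , U⊇) = boxes (∈-take⁻ r (A′⊆ w∈)) in
          ≤-trans (≤-reflexive (length-drop q (U w))) (∸-monoˡ-≤ q |U|≤) ,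
          λ {e} i → case U⊇ i of λ
            { (inj₂ e∈B) → inj₂ (∈-++⁺ʳ L e∈B)
            ; (inj₁ e∈U) → case ∈-take-drop q (U w) e∈U of λ
              { (inj₂ e∈) → inj₁ e∈
              ; (inj₁ e∈) → inj₂ (W⊆ (A′⊆ w∈) (∈-concatMap⁺ (take q ∘ U) (Any.map (λ { refl → e∈ }) (A′⊆ w∈))) i) } })
        (m≤n+o⇒m∸n≤o s q (≤-trans s≤ (≤-reflexive (trans (sym (+-assoc b _ q)) (+-comm _ q)))))
    where
    r q : ℕ
    r = suc (a * suc T)
    q = b / r
    W : List (Edge n)
    W = concatMap (take q ∘ U) (take r A)
    |A₀|≡ : length (take r A) ≡ r
    |A₀|≡ = trans (length-take r A) (m≤n⇒m⊓n≡m aT<|A|)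
    |W|≤b : length W ≤ b
    |W|≤b = ≤-trans (length-concatMap-≤ (λ w → length-take-≤ q (U w)) (take r A))
      (≤-trans (≤-reflexive (trans (cong (_* q) |A₀|≡) (*-comm r q))) (m/n*n≤m b r))

  -- `U` contains every edge within `A` that Breaker lacks, and shrinks by up to `b` a round while
  -- `A` loses at most `2a` vertices. The box phase enters as the continuation `next`, for whichever
  -- `r` or more vertices survive.
  wins-clique : ∀ R {r A B M} (U : List (Edge n)) →
    a * 2 * R + r ≤ length A → Unique A → AllClear M A →
    (∀ {e} → Within A e → e ∈ U ⊎ e ∈ B) → length U ≤ R * b →
    (∀ {A B M} → r ≤ length A → Unique A → AllClear M A → Owned B A → Wins B M) →
    Wins B M
  wins-clique zero [] r≤ A! clear within _ next =
    next (≤-trans (m≤n+m _ (a * 2 * 0)) r≤) A! clear λ i → [ (λ ()) , (λ e∈B → e∈B) ]′ (within i)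
  wins-clique (suc R) {r} {A} {B} U R≤ A! clear within |U|≤ next =
    wins-round 2 (take b U) (length-take-≤ b U) A! clear (λ {e} _ xs! xs⊆ → ≤2-incident {e = e} xs! (proj₂ ∘ xs⊆))
      λ {L} {L′} {A′} A′⊆ A′! clear′ |A|≤ W⊆ → wins-clique R (drop b U)
        (+-cancelˡ-≤ (a * 2) _ _ (≤-trans (≤-reflexive (trans (sym (+-assoc (a * 2) _ r)) (cong (_+ r) (sym (*-suc (a * 2) R)))))
          (≤-trans R≤ |A|≤)))
        A′! clear′
        (λ { {e} (u∈ , v∈) → case within (A′⊆ u∈ , A′⊆ v∈) of λ
          { (inj₂ e∈B) → inj₂ (∈-++⁺ʳ L e∈B)
          ; (inj₁ e∈U) → case ∈-take-drop b U e∈U of λ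
            { (inj₂ e∈) → inj₁ e∈
            -- Either end would do here, since both were clear before the round.
            ; (inj₁ e∈) → inj₂ (W⊆ (A′⊆ u∈) e∈ (inj₁ refl)) } } })
        (≤-trans (≤-reflexive (length-drop b U)) (m≤n+o⇒m∸n≤o _ b |U|≤))
        next

  -- Of the chosen vertices `a * 2 * R` may be spoilt in the `R` rounds of the clique phase; the box
  -- phase needs the other `a * T + 1`. The squared bound covers the list of edges among them.
  breaker-wins : ∀ R T → a * 2 * R + suc (a * T) ≤ n →
    (a * 2 * R + suc (a * T)) * (a * 2 * R + suc (a * T)) ≤ R * b → n ≤ b + boxSum a b T →
    BreakerHasWinningStrategy
  breaker-wins R T c≤n cc≤ n≤ = winning
    (wins-clique R (inside A₀) (≤-reflexive (sym |A₀|≡)) (Uniqueₚ.take⁺ c (allFin⁺ n)) (λ _ _ _ ()) (inj₁ ∘ ∈-inside)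
      (≤-trans (length-inside A₀) (subst (λ m → m * m ≤ R * b) (sym |A₀|≡) cc≤))
      λ aT< A! clear owned → wins-boxes T star aT< A! clear owned (λ {w} _ → length-star w , λ {e} i → inj₁ (∈-star {e = e} i)) n≤)
    where
    c : ℕ
    c = a * 2 * R + suc (a * T)
    A₀ : List (Fin n)
    A₀ = take c (allFin n)
    |A₀|≡ : length A₀ ≡ c
    |A₀|≡ = trans (length-take c (allFin n)) (trans (cong (c ⊓_) (length-tabulate {n = n} (λ i → i))) (m≤n⇒m⊓n≡m c≤n))

  -- The box game with the single box at `w`: one vertex spans no edge, so its clique is owned from
  -- the start.
  breaker-wins-at-once : Fin n → n ≤ b → BreakerHasWinningStrategy
  breaker-wins-at-once w n≤b = winning
    (wins-boxes 0 {A = w ∷ []} star (≤-reflexive (cong suc (*-zeroʳ a))) ([] ∷ []) (λ _ _ _ ())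
      (λ { {_ , _ , u<v} (here refl , here refl) → contradiction u<v (Finₚ.<-irrefl refl) })
      (λ {w} _ → length-star w , λ {e} i → inj₁ (∈-star {e = e} i))
      (≤-trans n≤b (≤-reflexive (sym (+-identityʳ b)))))

-- Harmonic sums

∑ : ℕ → (ℕ → ℕ) → ℕ
∑ zero    f = 0
∑ (suc m) f = ∑ m f + f m

∑-split : ∀ m p f → ∑ (m + p) f ≡ ∑ m f + ∑ p (λ r → f (m + r))
∑-split m zero    f = trans (cong (λ z → ∑ z f) (+-identityʳ m)) (sym (+-identityʳ _))
∑-split m (suc p) f = trans (cong (λ z → ∑ z f) (+-suc m p))
  (trans (cong (_+ f (m + p)) (∑-split m p f)) (+-assoc (∑ m f) _ _))

∑-monoˡ-≤ : ∀ f {m p} → m ≤ p → ∑ m f ≤ ∑ p f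
∑-monoˡ-≤ f {m} m≤p with m≤n⇒∃[o]m+o≡n m≤p
... | o , refl = ≤-trans (m≤m+n _ _) (≤-reflexive (sym (∑-split m o f)))

*-∑-≤ : ∀ m c {C} f → (∀ j → j < m → c * f j ≤ C) → c * ∑ m f ≤ m * C
*-∑-≤ zero    c     f h = ≤-reflexive (*-zeroʳ c)
*-∑-≤ (suc m) c {C} f h = begin
  c * (∑ m f + f m)      ≡⟨ *-distribˡ-+ c (∑ m f) (f m) ⟩
  c * ∑ m f + c * f m    ≤⟨ +-mono-≤ (*-∑-≤ m c f (λ j j<m → h j (m<n⇒m<1+n j<m))) (h m ≤-refl) ⟩
  m * C + C              ≡⟨ +-comm (m * C) C ⟩
  C + m * C              ∎
  where open ≤-Reasoning

≤-*-∑ : ∀ m c {C} f → (∀ j → j < m → C ≤ c * f j) → m * C ≤ c * ∑ m f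
≤-*-∑ zero    c     f h = z≤n
≤-*-∑ (suc m) c {C} f h = begin
  C + m * C              ≤⟨ +-mono-≤ (h m ≤-refl) (≤-*-∑ m c f (λ j j<m → h j (m<n⇒m<1+n j<m))) ⟩
  c * f m + c * ∑ m f    ≡⟨ +-comm (c * f m) _ ⟩
  c * ∑ m f + c * f m    ≡⟨ *-distribˡ-+ c (∑ m f) (f m) ⟨
  c * (∑ m f + f m)      ∎
  where open ≤-Reasoning

n<2^n : ∀ n → n < 2 ^ n
n<2^n zero    = ≤-refl
n<2^n (suc n) = begin-strict
  suc n              <⟨ s≤s (n<2^n n) ⟩
  1 + 2 ^ n          ≤⟨ +-mono-≤ (m^n>0 2 n) (≤-reflexive (sym (+-identityʳ (2 ^ n)))) ⟩
  2 ^ n + (2 ^ n + 0) ∎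
  where open ≤-Reasoning

floor-log : ∀ B → 2 ≤ B → ∀ n → 0 < n → ∃[ q ] B ^ q ≤ n × n < B ^ suc q
floor-log B 2≤B (suc zero) _ = 0 , ≤-refl , ≤-trans 2≤B (≤-reflexive (sym (*-identityʳ B)))
floor-log B 2≤B (suc (suc n)) _ with floor-log B 2≤B (suc n) z<s
... | q , lo , hi with m≤n⇒m<n∨m≡n hi
... | inj₁ hi′ = q , m≤n⇒m≤1+n lo , hi′
... | inj₂ eq  = suc q , ≤-reflexive (sym eq) , ≤-<-trans (≤-reflexive eq) (^-monoʳ-< B 2≤B (n<1+n (suc q)))

-- w j = D/(j + 1), so that ∑ m w is D times the m-th harmonic number.
module Harmonic (D : ℕ) (w : ℕ → ℕ) (w≤ : ∀ j → suc j * w j ≤ D) where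

  -- Doubling `suc y` appends `suc y` terms, each at most D/(y + 1), hence at most `D` in total.
  ∑-dyadic-≤ : ∀ k y {M} → M < 2 ^ k * suc y → ∑ M w ≤ ∑ y w + k * D
  ∑-dyadic-≤ zero    y M< = ≤-trans (∑-monoˡ-≤ w (s≤s⁻¹ (≤-trans M< (≤-reflexive (*-identityˡ _))))) (m≤m+n _ _)
  ∑-dyadic-≤ (suc k) y {M} M< = begin
    ∑ M w                                        ≤⟨ ∑-dyadic-≤ k (y + suc y) (≤-trans M< (≤-reflexive (double (2 ^ k) y))) ⟩
    ∑ (y + suc y) w + k * D                      ≡⟨ cong (_+ k * D) (∑-split y (suc y) w) ⟩
    ∑ y w + ∑ (suc y) (λ r → w (y + r)) + k * D  ≤⟨ +-monoˡ-≤ (k * D) (+-monoʳ-≤ (∑ y w) block) ⟩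
    ∑ y w + D + k * D                            ≡⟨ +-assoc (∑ y w) D (k * D) ⟩
    ∑ y w + (D + k * D)                          ∎
    where
    open ≤-Reasoning
    double : ∀ x y → 2 * x * suc y ≡ x * suc (y + suc y)
    double = solve-∀
    block : ∑ (suc y) (λ r → w (y + r)) ≤ D
    block = *-cancelˡ-≤ (suc y) (*-∑-≤ (suc y) (suc y) (λ r → w (y + r)) λ r _ →
      ≤-trans (*-monoˡ-≤ (w (y + r)) (s≤s (m≤m+n y r))) (w≤ (y + r)))

  -- Each doubling appends `suc y` terms, each at least D/(2(y + 1)), hence at least D/2 in total.
  ∑-dyadic-≥ : ∀ k {M} → 2 ^ k ≡ suc M → (∀ j → j < M → D ≤ suc j * w j) → k * D ≤ 2 * ∑ M w
  ∑-dyadic-≥ zero    {M} eq h = z≤n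
  ∑-dyadic-≥ (suc k) {M} eq h with 2 ^ k in eqk
  ... | zero  = contradiction eq λ ()
  ... | suc y with suc-injective eq
  ... | refl = begin
    D + k * D                                              ≤⟨ +-mono-≤ block (∑-dyadic-≥ k eqk λ j j<y → h j (≤-trans j<y (m≤m+n y _))) ⟩
    2 * ∑ (suc y) (λ r → w (y + r)) + 2 * ∑ y w            ≡⟨ shuffle (∑ (suc y) (λ r → w (y + r))) (∑ y w) ⟩
    2 * (∑ y w + ∑ (suc y) (λ r → w (y + r)))              ≡⟨ cong (2 *_) (∑-split y (suc y) w) ⟨
    2 * ∑ (y + suc y) w                                    ≡⟨ cong (λ z → 2 * ∑ (y + suc z) w) (+-identityʳ y) ⟨
    2 * ∑ (y + suc (y + 0)) w                              ∎
    where
    open ≤-Reasoning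
    shuffle : ∀ x y → 2 * x + 2 * y ≡ 2 * (y + x)
    shuffle = solve-∀
    assoc : ∀ y x → suc y * 2 * x ≡ suc y * (2 * x)
    assoc = solve-∀
    within : ∀ r → r < suc y → y + r < y + suc (y + 0)
    within r r≤y = +-monoʳ-< y (≤-trans r≤y (≤-reflexive (cong suc (sym (+-identityʳ y)))))
    block : D ≤ 2 * ∑ (suc y) (λ r → w (y + r))
    block = *-cancelˡ-≤ (suc y) (≤-trans
      (≤-*-∑ (suc y) (suc y * 2) (λ r → w (y + r)) λ r r<m → ≤-trans (h (y + r) (within r r<m))
        (*-monoˡ-≤ (w (y + r)) (≤-trans (within r r<m) (≤-trans (n≤1+n _) (≤-reflexive (*-comm 2 (suc y)))))))
      (≤-reflexive (assoc y (∑ (suc y) (λ r → w (y + r))))))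

  -- As aj + 1 ≤ a(j + 1), the quotient b/(a(j + 1)) is at most ⌊b/(aj + 1)⌋ + 1. The roundings add
  -- up to `T`, and `b * D` pays for the harmonic term 1.
  ∑-boxSum : ∀ a b T → 0 < a → b * ∑ (suc T) w ≤ b * D + a * (T + boxSum a b T) * D
  ∑-boxSum a b zero    a>0 = ≤-trans (*-monoʳ-≤ b (≤-trans (≤-reflexive (sym (+-identityʳ (w 0)))) (w≤ 0))) (m≤m+n (b * D) _)
  ∑-boxSum a b (suc T) a>0 = begin
    b * (∑ (suc T) w + w (suc T))                      ≡⟨ *-distribˡ-+ b (∑ (suc T) w) _ ⟩
    b * ∑ (suc T) w + b * w (suc T)                    ≤⟨ +-mono-≤ (∑-boxSum a b T a>0) last ⟩
    b * D + a * (T + S) * D + a * suc F * D            ≡⟨ shuffle a b D T S F ⟩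
    b * D + a * (suc T + (S + F)) * D                  ∎
    where
    open ≤-Reasoning
    r S F : ℕ
    r = suc (a * suc T)
    S = boxSum a b T
    F = b / r
    shuffle : ∀ a b D T S F → b * D + a * (T + S) * D + a * suc F * D ≡ b * D + a * (suc T + (S + F)) * D
    shuffle = solve-∀
    assoc : ∀ a t x y → a * t * x * y ≡ a * x * (t * y)
    assoc = solve-∀
    b≤ : b ≤ a * suc (suc T) * suc F
    b≤ = begin
      b                        ≡⟨ m≡m%n+[m/n]*n b r ⟩
      b % r + F * r            ≤⟨ +-monoˡ-≤ (F * r) (<⇒≤ (m%n<n b r)) ⟩
      r + F * r                ≡⟨ *-comm (suc F) r ⟩
      r * suc F                ≤⟨ *-monoˡ-≤ (suc F) (≤-trans (+-monoˡ-≤ (a * suc T) a>0) (≤-reflexive (sym (*-suc a (suc T))))) ⟩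
      a * suc (suc T) * suc F  ∎
    last : b * w (suc T) ≤ a * suc F * D
    last = begin
      b * w (suc T)                          ≤⟨ *-monoˡ-≤ (w (suc T)) b≤ ⟩
      a * suc (suc T) * suc F * w (suc T)    ≡⟨ assoc a (suc (suc T)) (suc F) _ ⟩
      a * suc F * (suc (suc T) * w (suc T))  ≤⟨ *-monoʳ-≤ (a * suc F) (w≤ (suc T)) ⟩
      a * suc F * D                          ∎

-- Choice of the parameters

-- Here 1/e plays the role of ε and N + 1 that of n.  Stopping at T = n / 2^(4q)
-- costs at most 4q + 1 ≤ 5q of a harmonic sum that is at least 10 (e + 1) q;
-- this loss of a factor 1 - 1/(2 (e + 1)) leaves 1 + 1/(2e) of the 1 + 1/e.
module Estimates
  (e : ℕ) .{{_ : NonZero e}} (a b N D q : ℕ) .{{_ : NonZero D}} (a>0 : 0 < a)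
  (w : ℕ → ℕ) (w≤ : ∀ j → suc j * w j ≤ D) (w≥ : ∀ j → j < N → D ≤ suc j * w j)
  (b<n : b < suc N)
  (bias : suc e * (a * suc N * D) ≤ e * (b * (a * D + ∑ N w)))
  (lower : 2 ^ (20 * suc e * q) ≤ suc N) (upper : suc N < 2 ^ (20 * suc e * suc q))
  (2e≤q : 2 * e ≤ q)
  (cube≤q : 16 * (e * (20 * suc e)) * (e * (20 * suc e)) * (e * (20 * suc e)) ≤ q)
  where

  open Harmonic D w w≤
  open ≤-Reasoning

  n p h r Y T : ℕ
  n = suc N
  p = 20 * suc e
  h = ∑ N w
  -- `r`, of order ln n, will bound both `a` and n/b. `Y` is a small power of `n` that still exceeds
  -- 16r³.
  r = e * p * suc q
  Y = 2 ^ (4 * q)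
  instance
    Y≢0 : NonZero Y
    Y≢0 = m^n≢0 2 (4 * q)
    r≢0 : NonZero r
    r≢0 = m*n≢0 (e * p) (suc q) {{m*n≢0 e p}}
  T = n / Y

  h≤ : h ≤ p * suc q * D
  h≤ = ∑-dyadic-≤ (p * suc q) 0 (<-trans (n<1+n N) (≤-trans upper (≤-reflexive (sym (*-identityʳ _)))))

  -- Since `b` is below `n`, the bias condition gives (e + 1)a ≤ e(a + h/D), so `a` is at most `e`
  -- times a harmonic number.
  aD≤ : a * D ≤ e * h
  aD≤ = +-cancelˡ-≤ (e * (a * D)) _ _ (*-cancelˡ-≤ n (begin
    n * (e * (a * D) + a * D)     ≡⟨ s₁ e a D n ⟩
    suc e * (a * n * D)           ≤⟨ bias ⟩
    e * (b * (a * D + h))         ≤⟨ *-monoʳ-≤ e (*-monoˡ-≤ (a * D + h) (<⇒≤ b<n)) ⟩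
    e * (n * (a * D + h))         ≡⟨ s₂ e n (a * D) h ⟩
    n * (e * (a * D) + e * h)     ∎))
    where
    s₁ : ∀ e a D n → n * (e * (a * D) + a * D) ≡ suc e * (a * n * D)
    s₁ = solve-∀
    s₂ : ∀ e n x h → e * (n * (x + h)) ≡ n * (e * x + e * h)
    s₂ = solve-∀

  eh≤ : e * h ≤ r * D
  eh≤ = ≤-trans (*-monoʳ-≤ e h≤) (≤-reflexive (s e p (suc q) D))
    where
    s : ∀ e p q D → e * (p * q * D) ≡ e * p * q * D
    s = solve-∀

  a≤r : a ≤ r
  a≤r = *-cancelʳ-≤ a r D (≤-trans aD≤ eh≤)

  -- Bounding `a * D` by `e * h` turns the last factor of the bias condition into (e + 1)h; then e +
  -- 1 cancels and an ≤ rb remains.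
  n≤rb : n ≤ r * b
  n≤rb = ≤-trans (≤-trans (≤-reflexive (sym (*-identityˡ n))) (*-monoˡ-≤ n a>0))
    (*-cancelʳ-≤ (a * n) (r * b) D (*-cancelˡ-≤ (suc e) (begin
      suc e * (a * n * D)           ≤⟨ bias ⟩
      e * (b * (a * D + h))         ≤⟨ *-monoʳ-≤ e (*-monoʳ-≤ b (+-monoˡ-≤ h aD≤)) ⟩
      e * (b * (e * h + h))         ≡⟨ s₁ e b h ⟩
      suc e * (b * (e * h))         ≤⟨ *-monoʳ-≤ (suc e) (*-monoʳ-≤ b eh≤) ⟩
      suc e * (b * (r * D))         ≡⟨ cong (suc e *_) (s₂ b r D) ⟩
      suc e * (r * b * D)           ∎)))
    where
    s₁ : ∀ e b h → e * (b * (e * h + h)) ≡ suc e * (b * (e * h))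
    s₁ = solve-∀
    s₂ : ∀ b r D → b * (r * D) ≡ r * b * D
    s₂ = solve-∀

  YT≤n : Y * T ≤ n
  YT≤n = ≤-trans (≤-reflexive (*-comm Y T)) (m/n*n≤m n Y)

  n<Y[1+T] : n < Y * suc T
  n<Y[1+T] = begin-strict
    n              ≡⟨ m≡m%n+[m/n]*n n Y ⟩
    n % Y + T * Y  <⟨ +-monoˡ-< (T * Y) (m%n<n n Y) ⟩
    Y + T * Y      ≡⟨ *-comm (suc T) Y ⟩
    Y * suc T      ∎

  T>0 : 0 < T
  T>0 = m≥n⇒m/n>0 (≤-trans (^-monoʳ-≤ 2 (*-monoˡ-≤ q (≤-trans (m≤m+n 4 _) (*-monoʳ-≤ 20 (s≤s (z≤n {e})))))) lower)

  Q : ℕ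
  Q = 2 ^ q

  Y≡ : Y ≡ Q * (Q * Q * Q)
  Y≡ = trans (cong (2 ^_) (*-comm 4 q)) (trans (sym (^-*-assoc 2 q 4)) (s Q))
    where
    s : ∀ Q → Q * (Q * (Q * (Q * 1))) ≡ Q * (Q * Q * Q)
    s = solve-∀

  -- The constant 16(ep)³ and the three factors q + 1 are each at most `2 ^ q`, and `Y` is the
  -- fourth power of that.
  16r³≤Y : 16 * r * r * r ≤ Y
  16r³≤Y = begin
    16 * r * r * r                                                    ≡⟨ s (e * p) (suc q) ⟩
    16 * (e * p) * (e * p) * (e * p) * (suc q * suc q * suc q)
      ≤⟨ *-mono-≤ (≤-trans cube≤q (<⇒≤ (n<2^n q))) (*-mono-≤ (*-mono-≤ (n<2^n q) (n<2^n q)) (n<2^n q)) ⟩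
    Q * (Q * Q * Q)                                                   ≡⟨ Y≡ ⟨
    Y                                                                 ∎
    where
    s : ∀ x q → 16 * (x * q) * (x * q) * (x * q) ≡ 16 * x * x * x * (q * q * q)
    s = solve-∀

  2e≤Y : 2 * e ≤ Y
  2e≤Y = ≤-trans 2e≤q (≤-trans (<⇒≤ (n<2^n q)) (^-monoʳ-≤ 2 (m≤m+n q (3 * q))))

  -- Two factors of r³ pay for a², the third for passing from `n` to `b`. The 16 is the square of
  -- the 4 in `c≤4aT`.
  16a²T≤b : 16 * a * a * T ≤ b
  16a²T≤b = *-cancelˡ-≤ r (begin
    r * (16 * a * a * T)  ≤⟨ *-monoʳ-≤ r (*-monoˡ-≤ T (*-mono-≤ (*-monoʳ-≤ 16 a≤r) a≤r)) ⟩
    r * (16 * r * r * T)  ≡⟨ s r T ⟩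
    16 * r * r * r * T    ≤⟨ *-monoˡ-≤ T 16r³≤Y ⟩
    Y * T                 ≤⟨ YT≤n ⟩
    n                     ≤⟨ n≤rb ⟩
    r * b                 ∎)
    where
    s : ∀ r T → r * (16 * r * r * T) ≡ 16 * r * r * r * T
    s = solve-∀

  c : ℕ
  c = a * 2 * T + suc (a * T)

  c≤4aT : c ≤ 4 * (a * T)
  c≤4aT = begin
    a * 2 * T + (1 + a * T)         ≤⟨ +-monoʳ-≤ (a * 2 * T) (+-monoˡ-≤ (a * T) (*-mono-≤ a>0 T>0)) ⟩
    a * 2 * T + (a * T + a * T)     ≡⟨ s a T ⟩
    4 * (a * T)                     ∎
    where
    s : ∀ a T → a * 2 * T + (a * T + a * T) ≡ 4 * (a * T)
    s = solve-∀

  c≤n : c ≤ n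
  c≤n = begin
    c                    ≤⟨ c≤4aT ⟩
    4 * (a * T)          ≤⟨ *-monoˡ-≤ (a * T) (≤-trans (m≤m+n 4 12) (≤-trans (≤-reflexive (sym (*-identityʳ 16))) (*-monoʳ-≤ 16 a>0))) ⟩
    16 * a * (a * T)     ≡⟨ *-assoc (16 * a) a T ⟨
    16 * a * a * T       ≤⟨ 16a²T≤b ⟩
    b                    ≤⟨ <⇒≤ b<n ⟩
    n                    ∎

  c²≤Tb : c * c ≤ T * b
  c²≤Tb = begin
    c * c                        ≤⟨ *-mono-≤ c≤4aT c≤4aT ⟩
    4 * (a * T) * (4 * (a * T))  ≡⟨ s a T ⟩
    T * (16 * a * a * T)         ≤⟨ *-monoʳ-≤ T 16a²T≤b ⟩
    T * b                        ∎
    where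
    s : ∀ a T → 4 * (a * T) * (4 * (a * T)) ≡ T * (16 * a * a * T)
    s = solve-∀

  H X : ℕ
  H = a * D + h
  X = T + (b + boxSum a b T)

  -- Cutting the harmonic sum from `N` down to `T` terms costs `4 * q * D`; the remaining `D` comes
  -- from the first term in `∑-boxSum`.
  bh≤ : b * H ≤ a * D * X + b * (suc (4 * q) * D)
  bh≤ = begin
    b * (a * D + h)                                                   ≡⟨ *-distribˡ-+ b (a * D) h ⟩
    b * (a * D) + b * h
      ≤⟨ +-monoʳ-≤ (b * (a * D)) (*-monoʳ-≤ b (≤-trans (∑-dyadic-≤ (4 * q) T (<-trans (n<1+n N) n<Y[1+T]))
                                                (+-monoˡ-≤ (4 * q * D) (∑-monoˡ-≤ w (n≤1+n T))))) ⟩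
    b * (a * D) + b * (∑ (suc T) w + 4 * q * D)                       ≡⟨ cong (λ z → b * (a * D) + z) (*-distribˡ-+ b (∑ (suc T) w) (4 * q * D)) ⟩
    b * (a * D) + (b * ∑ (suc T) w + b * (4 * q * D))                 ≤⟨ +-monoʳ-≤ (b * (a * D)) (+-monoˡ-≤ _ (∑-boxSum a b T a>0)) ⟩
    b * (a * D) + (b * D + a * (T + boxSum a b T) * D + b * (4 * q * D)) ≡⟨ s a b D T (boxSum a b T) q ⟩
    a * D * X + b * (suc (4 * q) * D)                                 ∎
    where
    s : ∀ a b D T S q → b * (a * D) + (b * D + a * (T + S) * D + b * (4 * q * D))
                      ≡ a * D * (T + (b + S)) + b * (suc (4 * q) * D)
    s = solve-∀

  -- This is where the 20 in `p` is spent: 5 for 4q + 1 ≤ 5q, 2 for the factor on the left, 2 for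
  -- the halves in `∑-dyadic-≥`.
  pq≤h : 2 * suc e * (suc (4 * q) * D) ≤ h
  pq≤h = *-cancelˡ-≤ 2 (begin
    2 * (2 * suc e * (suc (4 * q) * D))   ≤⟨ *-monoʳ-≤ 2 (*-monoʳ-≤ (2 * suc e) (*-monoˡ-≤ D (+-monoˡ-≤ (4 * q) q>0))) ⟩
    2 * (2 * suc e * ((q + 4 * q) * D))   ≡⟨ s (suc e) q D ⟩
    p * q * D                             ≤⟨ ∑-dyadic-≥ (p * q) (sym (suc-pred (2 ^ (p * q)) {{m^n≢0 2 (p * q)}})) (λ j j< → w≥ j (≤-trans j< M≤N)) ⟩
    2 * ∑ (pred (2 ^ (p * q))) w          ≤⟨ *-monoʳ-≤ 2 (∑-monoˡ-≤ w M≤N) ⟩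
    2 * h                                 ∎)
    where
    M≤N : pred (2 ^ (p * q)) ≤ N
    M≤N = pred-mono-≤ lower
    q>0 : 0 < q
    q>0 = ≤-trans (≤-trans (>-nonZero⁻¹ e) (m≤m+n e (e + 0))) 2e≤q
    s : ∀ e q D → 2 * (2 * e * ((q + 4 * q) * D)) ≡ 20 * e * q * D
    s = solve-∀

  -- The remaining gain 1 + 1/(2e) gives n + 2en ≤ 2eX, and the extra `n` absorbs the rounding loss
  -- 2eT ≤ YT ≤ n.
  n≤ : n ≤ b + boxSum a b T
  n≤ = *-cancelˡ-≤ (2 * e) {{m*n≢0 2 e}} (+-cancelˡ-≤ n _ _ (begin
    n + 2 * e * n                            ≤⟨ n≤2eX ⟩
    2 * e * X                                ≡⟨ *-distribˡ-+ (2 * e) T _ ⟩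
    2 * e * T + 2 * e * (b + boxSum a b T)   ≤⟨ +-monoˡ-≤ _ (≤-trans (*-monoˡ-≤ T 2e≤Y) YT≤n) ⟩
    n + 2 * e * (b + boxSum a b T)           ∎))
    where
    absorb : suc (2 * e) * (b * H) ≤ 2 * suc e * (a * D * X)
    absorb = +-cancelˡ-≤ (b * H) _ _ (begin
      b * H + suc (2 * e) * (b * H)                                        ≡⟨ s₁ e (b * H) ⟩
      2 * suc e * (b * H)                                                  ≤⟨ *-monoʳ-≤ (2 * suc e) bh≤ ⟩
      2 * suc e * (a * D * X + b * (suc (4 * q) * D))                      ≡⟨ s₂ (suc e) (a * D * X) b (suc (4 * q) * D) ⟩
      b * (2 * suc e * (suc (4 * q) * D)) + 2 * suc e * (a * D * X)        ≤⟨ +-monoˡ-≤ _ (*-monoʳ-≤ b (≤-trans pq≤h (m≤n+m h (a * D)))) ⟩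
      b * H + 2 * suc e * (a * D * X)                                      ∎)
      where
      s₁ : ∀ e x → x + suc (2 * e) * x ≡ 2 * suc e * x
      s₁ = solve-∀
      s₂ : ∀ e x b y → 2 * e * (x + b * y) ≡ b * (2 * e * y) + 2 * e * x
      s₂ = solve-∀
    -- The constants combine as (1 + 1/e)(1 - 1/(2(e + 1))) = 1 + 1/(2e).
    n≤2eX : n + 2 * e * n ≤ 2 * e * X
    n≤2eX = *-cancelˡ-≤ (suc e * (a * D)) {{m*n≢0 (suc e) (a * D) {{_}} {{m*n≢0 a D {{>-nonZero a>0}}}}}} (begin
      suc e * (a * D) * (n + 2 * e * n)      ≡⟨ s₁ e a D n ⟩
      suc (2 * e) * (suc e * (a * n * D))    ≤⟨ *-monoʳ-≤ (suc (2 * e)) bias ⟩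
      suc (2 * e) * (e * (b * H))            ≡⟨ s₂ (suc (2 * e)) e (b * H) ⟩
      e * (suc (2 * e) * (b * H))            ≤⟨ *-monoʳ-≤ e absorb ⟩
      e * (2 * suc e * (a * D * X))          ≡⟨ s₃ e (a * D) X ⟩
      suc e * (a * D) * (2 * e * X)          ∎)
      where
      s₁ : ∀ e a D n → suc e * (a * D) * (n + 2 * e * n) ≡ suc (2 * e) * (suc e * (a * n * D))
      s₁ = solve-∀
      s₂ : ∀ x e y → x * (e * y) ≡ e * (x * y)
      s₂ = solve-∀
      s₃ : ∀ e x X → e * (2 * suc e * (x * X)) ≡ suc e * x * (2 * e * X)
      s₃ = solve-∀

-- The logarithm and the bias condition

toℚᵘ-÷ : ∀ m d → ℚ.toℚᵘ (+ m ℚ./ suc d) ℚᵘ.≃ mkℚᵘ (+ m) d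
toℚᵘ-÷ m d = ℚₚ.toℚᵘ-fromℚᵘ (mkℚᵘ (+ m) d)

÷-mono-≤ : ∀ m n d e .{{_ : NonZero d}} .{{_ : NonZero e}} → m * e ≤ n * d → + m ℚ./ d ℚ.≤ + n ℚ./ e
÷-mono-≤ m n (suc d) (suc e) h = ℚₚ.toℚᵘ-cancel-≤ (ℚᵘₚ.≤-respˡ-≃ (ℚᵘₚ.≃-sym (toℚᵘ-÷ m d))
  (ℚᵘₚ.≤-respʳ-≃ (ℚᵘₚ.≃-sym (toℚᵘ-÷ n e))
    (*≤* (subst₂ ℤ._≤_ (ℤₚ.pos-* m (suc e)) (ℤₚ.pos-* n (suc d)) (ℤ.+≤+ h)))))

÷-cancel-≤ : ∀ m n d e .{{_ : NonZero d}} .{{_ : NonZero e}} → + m ℚ./ d ℚ.≤ + n ℚ./ e → m * e ≤ n * d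
÷-cancel-≤ m n (suc d) (suc e) h
  with ℚᵘₚ.≤-respˡ-≃ (toℚᵘ-÷ m d) (ℚᵘₚ.≤-respʳ-≃ (toℚᵘ-÷ n e) (ℚₚ.toℚᵘ-mono-≤ h))
... | *≤* le = ℤₚ.drop‿+≤+ (subst₂ ℤ._≤_ (sym (ℤₚ.pos-* m (suc e))) (sym (ℤₚ.pos-* n (suc d))) le)

÷-homo-+ : ∀ m n d e .{{_ : NonZero d}} .{{_ : NonZero e}} →
           + m ℚ./ d ℚ.+ + n ℚ./ e ≡ (+ (m * e + n * d) ℚ./ (d * e)) {{m*n≢0 d e}}
÷-homo-+ m n (suc d) (suc e) = ℚₚ.toℚᵘ-injective (ℚᵘₚ.≃-trans (ℚₚ.toℚᵘ-homo-+ (+ m ℚ./ suc d) (+ n ℚ./ suc e))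
  (ℚᵘₚ.≃-trans (ℚᵘₚ.+-cong (toℚᵘ-÷ m d) (toℚᵘ-÷ n e))
    (ℚᵘₚ.≃-trans (ℚᵘₚ.≃-reflexive (cong (λ z → mkℚᵘ z _)
        (cong₂ ℤ._+_ (sym (ℤₚ.pos-* m (suc e))) (sym (ℤₚ.pos-* n (suc d))))))
      (ℚᵘₚ.≃-sym (toℚᵘ-÷ (m * suc e + n * suc d) _)))))

÷-homo-* : ∀ m n d e .{{_ : NonZero d}} .{{_ : NonZero e}} →
           (+ m ℚ./ d) ℚ.* (+ n ℚ./ e) ≡ (+ (m * n) ℚ./ (d * e)) {{m*n≢0 d e}}
÷-homo-* m n (suc d) (suc e) = ℚₚ.toℚᵘ-injective (ℚᵘₚ.≃-trans (ℚₚ.toℚᵘ-homo-* (+ m ℚ./ suc d) (+ n ℚ./ suc e))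
  (ℚᵘₚ.≃-trans (ℚᵘₚ.*-cong (toℚᵘ-÷ m d) (toℚᵘ-÷ n e))
    (ℚᵘₚ.≃-trans (ℚᵘₚ.≃-reflexive (cong (λ z → mkℚᵘ z _) (sym (ℤₚ.pos-* m n))))
      (ℚᵘₚ.≃-sym (toℚᵘ-÷ (m * n) _)))))

archimedean : ∀ δ → 0ℚ ℚ.< δ → ∃[ d ] + 1 ℚ./ suc d ℚ.≤ δ
archimedean δ@(ℚ.mkℚ (+ suc n) d _) _ = d , ℚₚ.toℚᵘ-cancel-≤
  (ℚᵘₚ.≤-respˡ-≃ (ℚᵘₚ.≃-sym (toℚᵘ-÷ 1 d))
    (*≤* (ℤ.+≤+ (*-monoˡ-≤ (suc d) (s≤s (z≤n {n}))))))
archimedean (ℚ.mkℚ (+ zero) d _) (ℚ.*<* (ℤ.+<+ ()))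
archimedean (ℚ.mkℚ (ℤ.-[1+ n ]) d _) (ℚ.*<* ())

∑<-≤ : ∀ J E .{{_ : NonZero E}} {f : ℕ → ℚ} (g : ℕ → ℕ) →
       (∀ j → j < J → f j ℚ.≤ + g j ℚ./ E) → ∑< J f ℚ.≤ + ∑ J g ℚ./ E
∑<-≤ zero    E g h = ÷-mono-≤ 0 0 1 E z≤n
∑<-≤ (suc J) E g h = ℚₚ.≤-trans
  (ℚₚ.+-mono-≤ (∑<-≤ J E g (λ j j<J → h j (m<n⇒m<1+n j<J))) (h J ≤-refl))
  (ℚₚ.≤-trans (ℚₚ.≤-reflexive (÷-homo-+ (∑ J g) (g J) E E))
    (÷-mono-≤ (∑ J g * E + g J * E) (∑ J g + g J) (E * E) E {{m*n≢0 E E}} (≤-reflexive (s (∑ J g) (g J) E))))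
  where
  s : ∀ x y E → (x * E + y * E) * E ≡ (x + y) * (E * E)
  s = solve-∀

∑-blocks-≤ : ∀ M m .{{_ : NonZero m}} (w : ℕ → ℕ) → ∑ (M * m) (λ j → w (j / m)) ≤ m * ∑ M w
∑-blocks-≤ zero    m w = z≤n
∑-blocks-≤ (suc M) m w = begin
  ∑ (m + M * m) v                                ≡⟨ cong (λ z → ∑ z v) (+-comm m (M * m)) ⟩
  ∑ (M * m + m) v                                ≡⟨ ∑-split (M * m) m v ⟩
  ∑ (M * m) v + ∑ m (λ r → v (M * m + r))        ≤⟨ +-mono-≤ (∑-blocks-≤ M m w) block ⟩
  m * ∑ M w + m * w M                            ≡⟨ *-distribˡ-+ m (∑ M w) (w M) ⟨
  m * (∑ M w + w M)                              ∎
  where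
  open ≤-Reasoning
  v : ℕ → ℕ
  v j = w (j / m)
  quotient : ∀ r → r < m → (M * m + r) / m ≡ M
  quotient r r<m = trans (+-distrib-/-∣ˡ r (divides-refl M))
    (trans (cong₂ _+_ (m*n/n≡m M m) (m<n⇒m/n≡0 r<m)) (+-identityʳ M))
  block : ∑ m (λ r → v (M * m + r)) ≤ m * w M
  block = ≤-trans (≤-reflexive (sym (*-identityˡ _)))
    (*-∑-≤ m 1 (λ r → v (M * m + r)) λ r r<m → ≤-reflexive (trans (*-identityˡ _) (cong w (quotient r r<m))))

-- Every Riemann sum for ln n is at most the harmonic number of n - 1: on the unit interval from q +
-- 1 to q + 2, with q = ⌊j/m⌋, each of the `m` terms is at most 1/(m(q + 1)).
lnSum-≤ : ∀ n i D .{{_ : NonZero D}} (w : ℕ → ℕ) → (∀ j → j < n ∸ 1 → D ≤ suc j * w j) →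
          lnSum n i ℚ.≤ + ∑ (n ∸ 1) w ℚ./ D
lnSum-≤ n i D w w≥ = ℚₚ.≤-trans
  (∑<-≤ (M * m) (m * D) {{m*n≢0 m D}} (λ j → w (j / m)) term)
  (÷-mono-≤ (∑ (M * m) (λ j → w (j / m))) (∑ M w) (m * D) D {{m*n≢0 m D}} (≤-trans (*-monoˡ-≤ D (∑-blocks-≤ M m w)) (≤-reflexive (s m (∑ M w) D))))
  where
  M m : ℕ
  M = n ∸ 1
  m = suc i
  s : ∀ m h D → m * h * D ≡ h * (m * D)
  s = solve-∀
  s′ : ∀ m q w → m * (suc q * w) ≡ w * (m + q * m)
  s′ = solve-∀
  term : ∀ j → j < M * m → + 1 ℚ./ (m + suc j) ℚ.≤ (+ w (j / m) ℚ./ (m * D)) {{m*n≢0 m D}}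
  term j j< = ÷-mono-≤ 1 (w q) (m + suc j) (m * D) {{_}} {{m*n≢0 m D}} (begin
    1 * (m * D)                  ≡⟨ *-identityˡ (m * D) ⟩
    m * D                        ≤⟨ *-monoʳ-≤ m (w≥ q (m<n*o⇒m/o<n {o = m} j<)) ⟩
    m * (suc q * w q)            ≡⟨ s′ m q (w q) ⟩
    w q * (m + q * m)            ≤⟨ *-monoʳ-≤ (w q) (+-monoʳ-≤ m (≤-trans (m/n*n≤m j m) (n≤1+n j))) ⟩
    w q * (m + suc j)            ∎)
    where
    open ≤-Reasoning
    q : ℕ
    q = j / m

-- Half of the gain 1/(d + 1) is given up: as an ≥ 1, it absorbs the error term 1/(2(d + 1)).
bias-≤ : ∀ a b n d D h .{{_ : NonZero D}} → 0 < a → 0 < n →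
  (+ (a * n) ℚ./ 1) ℚ.* (+ 1 ℚ./ 1 ℚ.+ + 1 ℚ./ suc d) ℚ.≤
    (+ b ℚ./ 1) ℚ.* (+ a ℚ./ 1 ℚ.+ + h ℚ./ D) ℚ.+ + 1 ℚ./ (2 * suc d) →
  suc (2 * suc d) * (a * n * D) ≤ 2 * suc d * (b * (a * D + h))
bias-≤ a b n d D h a>0 n>0 le = +-cancelˡ-≤ D _ _ (begin
  D + suc (2 * f) * (a * n * D)          ≤⟨ +-monoˡ-≤ _ (≤-trans (≤-reflexive (sym (*-identityˡ D))) (*-monoˡ-≤ D (*-mono-≤ a>0 n>0))) ⟩
  a * n * D + suc (2 * f) * (a * n * D)  ≡⟨ s₁ (a * n) f D ⟩
  2 * (a * n * suc f * D)                ≤⟨ *-cancelˡ-≤ f scaled ⟩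
  D + 2 * f * (b * (a * D + h))          ∎)
  where
  open ≤-Reasoning
  f u v : ℕ
  f = suc d
  u = 1 * f + 1 * 1
  v = a * D + h * 1
  s₁ : ∀ x f D → x * D + suc (2 * f) * (x * D) ≡ 2 * (x * suc f * D)
  s₁ = solve-∀
  s₂ : ∀ x f D → f * (2 * (x * suc f * D)) ≡ x * (1 * f + 1 * 1) * (1 * (1 * D) * (2 * f))
  s₂ = solve-∀
  s₃ : ∀ a b f D h → (b * (a * D + h * 1) * (2 * f) + 1 * (1 * (1 * D))) * (1 * (1 * f)) ≡ f * (D + 2 * f * (b * (a * D + h)))
  s₃ = solve-∀
  instance
    1D≢0 : NonZero (1 * D)
    1D≢0 = m*n≢0 1 D
    11D≢0 : NonZero (1 * (1 * D))
    11D≢0 = m*n≢0 1 (1 * D)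
    11D2f≢0 : NonZero (1 * (1 * D) * (2 * f))
    11D2f≢0 = m*n≢0 (1 * (1 * D)) (2 * f)
  scaled : f * (2 * (a * n * suc f * D)) ≤ f * (D + 2 * f * (b * (a * D + h)))
  scaled = subst₂ _≤_ (sym (s₂ (a * n) f D)) (s₃ a b f D h)
    (÷-cancel-≤ (a * n * u) (b * v * (2 * f) + 1 * (1 * (1 * D))) (1 * (1 * f)) (1 * (1 * D) * (2 * f))
      (subst₂ ℚ._≤_
        (trans (cong ((+ (a * n) ℚ./ 1) ℚ.*_) (÷-homo-+ 1 1 1 f)) (÷-homo-* (a * n) u 1 (1 * f)))
        (trans (cong (ℚ._+ + 1 ℚ./ (2 * f)) (trans (cong ((+ b ℚ./ 1) ℚ.*_) (÷-homo-+ a h 1 D)) (÷-homo-* b v 1 (1 * D))))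
               (÷-homo-+ (b * v) 1 (1 * (1 * D)) (2 * f)))
        le))

-- Integer bias condition and passage to real ε

≤-*-!/ : ∀ {n j} → j < n → n ! ≤ suc j * (n ! / suc j)
≤-*-!/ {n} {j} j<n = ≤-reflexive (trans
  (sym (m/n*n≡m (∣-trans (m∣m*n {suc j} (j !)) (m≤n⇒m!∣n! j<n))))
  (*-comm _ (suc j)))

-- The factorial clears the denominators 1, …, N of the harmonic sum.
breaker-wins-if-biased : ∀ e .{{_ : NonZero e}} → ∃[ n₀ ] ∀ N → n₀ ≤ N → ∀ a b k → 0 < a → 0 < k →
  suc e * (a * suc N * suc N !) ≤ e * (b * (a * suc N ! + ∑ N (λ j → suc N ! / suc j))) →
  BreakerWinsMinDegreeGame (suc N) a b k
breaker-wins-if-biased e = B ^ (K + 2 * e) , wins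
  where
  B K : ℕ
  B = 2 ^ (20 * suc e)
  K = 16 * (e * (20 * suc e)) * (e * (20 * suc e)) * (e * (20 * suc e))
  instance
    B≢0 : NonZero B
    B≢0 = m^n≢0 2 (20 * suc e)
  2≤B : 2 ≤ B
  2≤B = ^-monoʳ-≤ 2 {1} {20 * suc e} (s≤s z≤n)
  wins : ∀ N → B ^ (K + 2 * e) ≤ N → ∀ a b k → 0 < a → 0 < k →
    suc e * (a * suc N * suc N !) ≤ e * (b * (a * suc N ! + ∑ N (λ j → suc N ! / suc j))) →
    BreakerWinsMinDegreeGame (suc N) a b k
  wins N n₀≤N a b k a>0 k>0 bias with b <? suc N
  ... | no  b≮n = Play.breaker-wins-at-once (suc N) a b k k>0 Fin.zero (≮⇒≥ b≮n)
  ... | yes b<n with floor-log B 2≤B (suc N) z<s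
  ... | q , lower , upper = Play.breaker-wins (suc N) a b k k>0 E.T E.T E.c≤n E.c²≤Tb E.n≤
    where
    -- The threshold is a power of `B`, so that beyond it the logarithm `q` to base `B` is at least
    -- the exponent.
    n₀≤q : K + 2 * e ≤ q
    n₀≤q = ≮⇒≥ λ q<n₀ → <⇒≱ upper (≤-trans (^-monoʳ-≤ B q<n₀) (m≤n⇒m≤1+n n₀≤N))
    module E = Estimates e a b N (suc N !) q {{suc N !≢0}} a>0 (λ j → suc N ! / suc j)
      (λ j → ≤-trans (≤-reflexive (*-comm (suc j) _)) (m/n*n≤m (suc N !) (suc j)))
      (λ j → ≤-*-!/ ∘ m<n⇒m<1+n) b<n bias
      (subst (_≤ suc N) (^-*-assoc 2 (20 * suc e) q) lower)
      (subst (suc N <_) (^-*-assoc 2 (20 * suc e) (suc q)) upper)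
      (≤-trans (m≤n+m (2 * e) K) n₀≤q) (≤-trans (m≤m+n K (2 * e)) n₀≤q)

theorem12 : (a k : ℕ → ℕ) → (∀ n → 0 < a n) → (∀ n → 0 < k n) →
    k =o[n] → a =o[√n] →
    (ε : ℝ) → 0ℝ <ℝ ε →
    ∃[ n₀ ] (∀ n → n₀ ≤ n → ∀ b →
    b · (fromℕ (a n) +ℝ ln n) ≥ℝ (a n * n) · (1ℝ +ℝ ε) →
    BreakerWinsMinDegreeGame n (a n) b (k n))
theorem12 a k a>0 k>0 _ _ ε (δ , δ>0 , N₀ , ε≥δ) with archimedean δ δ>0
... | d , 1/d≤δ with breaker-wins-if-biased (2 * suc d)
... | n₀ , wins = suc n₀ , λ { (suc N) (s≤s n₀≤N) b b≥ →
    wins N n₀≤N (a (suc N)) b (k (suc N)) (a>0 (suc N)) (k>0 (suc N)) (biased N b b≥) }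
  where
  biased : ∀ N b → b · (fromℕ (a (suc N)) +ℝ ln (suc N)) ≥ℝ (a (suc N) * suc N) · (1ℝ +ℝ ε) →
    suc (2 * suc d) * (a (suc N) * suc N * suc N !) ≤
      2 * suc d * (b * (a (suc N) * suc N ! + ∑ N (λ j → suc N ! / suc j)))
  -- The tolerance in the real inequality is set to the error that `bias-≤` can absorb.
  biased N b b≥ with b≥ (+ 1 ℚ./ (2 * suc d)) (ℚₚ.positive⁻¹ _ {{ℚₚ.normalize-pos 1 (2 * suc d)}})
  ... | N₁ , le = bias-≤ A b n d D (∑ N w) {{n !≢0}} (a>0 n) z<s (begin
    (+ (A * n) ℚ./ 1) ℚ.* (+ 1 ℚ./ 1 ℚ.+ + 1 ℚ./ suc d)
      ≤⟨ ℚₚ.*-monoˡ-≤-nonNeg (+ (A * n) ℚ./ 1) {{ℚₚ.normalize-nonNeg (A * n) 1}} (ℚₚ.+-monoʳ-≤ (+ 1 ℚ./ 1)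
           (ℚₚ.≤-trans 1/d≤δ (ℚₚ.≤-trans (ℚₚ.≤-reflexive (sym (ℚₚ.+-identityˡ δ))) (ε≥δ i (m≤m⊔n N₀ N₁))))) ⟩
    (+ (A * n) ℚ./ 1) ℚ.* (+ 1 ℚ./ 1 ℚ.+ approx ε i)
      ≤⟨ le i (m≤n⊔m N₀ N₁) ⟩
    (+ b ℚ./ 1) ℚ.* (+ A ℚ./ 1 ℚ.+ lnSum n i) ℚ.+ + 1 ℚ./ (2 * suc d)
      ≤⟨ ℚₚ.+-monoˡ-≤ (+ 1 ℚ./ (2 * suc d)) (ℚₚ.*-monoˡ-≤-nonNeg (+ b ℚ./ 1) {{ℚₚ.normalize-nonNeg b 1}}
           (ℚₚ.+-monoʳ-≤ (+ A ℚ./ 1) (lnSum-≤ n i D {{n !≢0}} w λ j → ≤-*-!/ ∘ m<n⇒m<1+n))) ⟩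
    (+ b ℚ./ 1) ℚ.* (+ A ℚ./ 1 ℚ.+ (+ ∑ N w ℚ./ D) {{n !≢0}}) ℚ.+ + 1 ℚ./ (2 * suc d) ∎)
    where
    open ℚₚ.≤-Reasoning
    n A D i : ℕ
    n = suc N
    A = a n
    D = n !
    -- At this index the approximation of `ε` is already at least `δ` and the bias inequality holds
    -- up to the tolerance.
    i = N₀ ⊔ N₁
    w : ℕ → ℕ
    w j = D / suc j
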